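{- For any fixed integer $r\geq 6$, any $\epsilon<1$ and any $n\geq r+(\frac{1}{\epsilon})^{\Theta(1/\epsilon)}$, there is an $n$-vertex edge-weighted graph $G$ excluding $K_r$ as a minor such that every $(1+\epsilon)$-spanner of $G$ has lightness $\Omega\left(\frac{r}{\epsilon}+\frac{1}{\epsilon^2}\right)$.
   Context: For an edge-weighted graph $G=(V,E,w)$ and $t\geq 1$, a $t$-spanner of $G$ is a spanning subgraph $H$ with $d_H(u,v)\leq t\cdot d_G(u,v)$ for all $u,v\in V$. The lightness of $H$ is $w(H)/w(\mathrm{MST}(G))$, where $w(H)$ is the total edge weight of $H$ and $\mathrm{MST}(G)$ is a minimum spanning tree of $G$.
   Formalization: The parameter ε is taken to be a rational number with 0 < ε < 1 instead of an arbitrary real; the edge weights of the constructed graph G are rational. -}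

module Defs where

open import Data.Nat using (ℕ; zero; suc; _∸_; _<ᵇ_)
open import Data.Fin using (Fin; toℕ)
open import Data.List using (List; map; foldr; allFin; length; filter)
open import Data.Bool using (Bool; true; false; if_then_else_; _∧_)
open import Data.Maybe using (Maybe; just; nothing)
open import Data.Integer using (+_; ∣_∣)
open import Data.Rational using (ℚ; 0ℚ; 1ℚ; _+_; _*_; _≤_; _<_; _/_; 1/_; ceiling)
open import Data.Rational.Properties using (pos⇒nonZero)
open import Data.Rational.Base using (positive)
open import Data.Product using (Σ; ∃; _×_; _,_)
open import Relation.Binary.PropositionalEquality using (_≡_; _≢_)

ℕ→ℚ : ℕ → ℚ
ℕ→ℚ n = + n / 1

_^ℚ_ : ℚ → ℕ → ℚ
p ^ℚ zero  = 1ℚ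
p ^ℚ suc k = p * (p ^ℚ k)

inv : (ε : ℚ) → 0ℚ < ε → ℚ
inv ε ε>0 = 1/_ ε {{pos⇒nonZero ε {{positive ε>0}}}}

-- ⌈ q ⌉ as a natural number (used for q > 0)
ceilℕ : ℚ → ℕ
ceilℕ q = ∣ ceiling q ∣

sumℚ : List ℚ → ℚ
sumℚ = foldr _+_ 0ℚ

record WGraph (n : ℕ) : Set where
  field
    adj     : Fin n → Fin n → Bool
    wt      : Fin n → Fin n → ℚ
    adj-sym : ∀ u v → adj u v ≡ adj v u
    adj-irr : ∀ u → adj u u ≡ false
    wt-sym  : ∀ u v → wt u v ≡ wt v u
    wt-pos  : ∀ u v → adj u v ≡ true → 0ℚ < wt u v
open WGraph public

EdgeSet : ℕ → Set
EdgeSet n = Fin n → Fin n → Bool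

IsSubgraph : ∀ {n} → WGraph n → EdgeSet n → Set
IsSubgraph {n} G S =
  (∀ (u v : Fin n) → S u v ≡ S v u) × (∀ (u v : Fin n) → S u v ≡ true → adj G u v ≡ true)

data Walk {n : ℕ} (S : EdgeSet n) : Fin n → Fin n → Set where
  []  : ∀ {u} → Walk S u u
  _∷_ : ∀ {u v x} → S u v ≡ true → Walk S v x → Walk S u x

walkWeight : ∀ {n} {S : EdgeSet n} → WGraph n → ∀ {u v} → Walk S u v → ℚ
walkWeight G [] = 0ℚ
walkWeight G (_∷_ {u} {v} _ p) = wt G u v + walkWeight G p

data WalkIn {n : ℕ} {S : EdgeSet n} (P : Fin n → Set) : ∀ {u v} → Walk S u v → Set where
  []  : ∀ {u} → P u → WalkIn P ([] {u = u})
  _∷_ : ∀ {u v x} {e : S u v ≡ true} {p : Walk S v x} → P u → WalkIn P p → WalkIn P (e ∷ p)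

totalWeight : ∀ {n} → WGraph n → EdgeSet n → ℚ
totalWeight {n} G S =
  sumℚ (map (λ i → sumℚ (map (λ j → if (toℕ i <ᵇ toℕ j) ∧ S i j then wt G i j else 0ℚ)
                                (allFin n)))
            (allFin n))

edgeCount : ∀ {n} → EdgeSet n → ℕ
edgeCount {n} S =
  foldr Data.Nat._+_ 0
    (map (λ i → length (filter (λ j → Data.Bool.T? ((toℕ i <ᵇ toℕ j) ∧ S i j)) (allFin n)))
         (allFin n))

IsConnected : ∀ {n} → EdgeSet n → Set
IsConnected {n} S = ∀ (u v : Fin n) → Walk S u v

IsSpanningTree : ∀ {n} → WGraph n → EdgeSet n → Set
IsSpanningTree {n} G T = IsSubgraph G T × IsConnected T × (edgeCount T ≡ n ∸ 1)

IsMST : ∀ {n} → WGraph n → EdgeSet n → Set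
IsMST G T = IsSpanningTree G T × (∀ T' → IsSpanningTree G T' → totalWeight G T ≤ totalWeight G T')

-- t-spanner: spanning subgraph H with d_H(u,v) ≤ t·d_G(u,v) for all u,v,
-- written out via the definition of d as the minimum walk weight
-- (for every u–v walk P in G there is a u–v walk Q in H with w(Q) ≤ t·w(P)).
IsSpanner : ∀ {n} → ℚ → WGraph n → EdgeSet n → Set
IsSpanner {n} t G H =
  IsSubgraph G H ×
  (∀ (u v : Fin n) (P : Walk (adj G) u v) →
     Σ (Walk H u v) (λ Q → walkWeight G Q ≤ t * walkWeight G P))

-- G has K_r as a minor: r pairwise disjoint, nonempty branch sets
-- (vertex v lies in branch set β v, or in none), each inducing a connected
-- subgraph, and every two distinct branch sets joined by an edge.
HasMinor : ∀ {n} → WGraph n → ℕ → Set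
HasMinor {n} G r =
  Σ (Fin n → Maybe (Fin r)) λ β →
    (∀ (i : Fin r) → ∃ λ (v : Fin n) → β v ≡ just i) ×
    (∀ (i : Fin r) (u v : Fin n) → β u ≡ just i → β v ≡ just i →
       Σ (Walk (adj G) u v) (λ p → WalkIn (λ x → β x ≡ just i) p)) ×
    (∀ (i j : Fin r) → i ≢ j →
       ∃ λ (u : Fin n) → ∃ λ (v : Fin n) →
         (β u ≡ just i) × (β v ≡ just j) × (adj G u v ≡ true))

{-# OPTIONS --safe #-}
-- Both kinds of graphs are a path 0, 1, …, n - 1 of unit edges together with chords.  The
-- minimum spanning tree weighs at most n - 1, so the lightness is large as soon as the
-- chords are heavy and every (1 + ε)-spanner contains all of them.  With K = ⌈1/ε⌉ and
-- q = K - 1 we have q ε < 1, so a chord of weight w is contained in every spanner if all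
-- detours have weight at least (1 + 1/q) w; a 1-Lipschitz potential certifies this.
--
-- If r ≥ 3K, all pairs whose distance along the path is in [h, 2h), where h = ⌊r/3⌋, are
-- joined by chords of weight q.  The bandwidth is below r - 1, which excludes K_r, and
-- each vertex contributes about h q = Θ(r/ε).
--
-- If r < 3K, then 1/ε² dominates r/ε.  A copy of depth l + 1 consists of 2(q + 1) consecutive
-- copies of depth l, with a chord of weight q (2q)^l between the i-th and the (i + q + 1)-st
-- of their ends.  Its ends are 2(q + 1) (2q)^l apart before and (2q)^(l+1) after these chords
-- are added: a level shortens distances only by the factor q/(q + 1), so each of the
-- first q/2 levels has total chord weight Ω(q n), which adds up to Ω(n/ε²).  Every copy is a
-- ladder that meets the rest of the graph in its two ends; hence the treewidth is at most
-- 4 and there is no K_6 minor.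
module Submission where

open import Defs
open import Data.Bool as Bool using (Bool; true; false; if_then_else_; _∧_; _∨_; T; T?)
import Data.Bool.Properties as Bool
open import Data.Empty using (⊥-elim)
open import Data.Fin as Fin using (Fin; toℕ; fromℕ<)
import Data.Fin.Properties as Fin
open import Data.Integer as ℤ using (-[1+_])
import Data.Integer.DivMod as ℤ
import Data.Integer.Properties as ℤ
open import Data.List as List using (List; []; _∷_; length; filter; allFin; map; applyUpTo)
import Data.List.Extrema.Nat as Extrema
open import Data.List.Membership.Propositional using (_∈_)
open import Data.List.Membership.Propositional.Properties
  using (∈-allFin; ∈-applyUpTo⁺; ∈-applyUpTo⁻; ∈-filter⁺; ∈-map⁺; ∈-map⁻)
import Data.List.Properties as List
import Data.List.Relation.Unary.All as All
open import Data.List.Relation.Unary.All.Properties using (all-filter)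
open import Data.List.Relation.Unary.Any using (here; there; index)
open import Data.List.Relation.Unary.Any.Properties using (lookup-index)
open import Data.Maybe using (just)
import Data.Maybe.Properties as Maybe
open import Data.Nat using (ℕ)
open import Data.Nat as ℕ using (zero; suc; z≤n; s≤s; NonZero; ⌈_/2⌉)
import Data.Nat.Divisibility as ℕ
import Data.Nat.DivMod as ℕ
open import Data.Nat.ListAction using (sum)
import Data.Nat.Properties as ℕ
open import Data.Nat.Tactic.RingSolver using (solve-∀)
open import Data.Product using (Σ; ∃; _×_; _,_; proj₁; proj₂)
open import Data.Rational as ℚ using (ℚ; mkℚ; 0ℚ; 1ℚ; toℚᵘ; *<*)
import Data.Rational.Properties as ℚ
open import Data.Rational.Unnormalised as ℚᵘ using (mkℚᵘ; *≤*; *<*; *≡*)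
import Data.Rational.Unnormalised.Properties as ℚᵘ
open import Data.Sum as Sum using (_⊎_; inj₁; inj₂)
open import Data.Unit using (⊤; tt)
open import Function using (_∘_; id; Equivalence)
open import Relation.Binary using (tri<; tri≈; tri>)
open import Relation.Binary.PropositionalEquality
open import Relation.Nullary using (¬_; Dec; yes; no)
open import Relation.Unary using (Decidable)

-- Natural numbers as rationals, and ceilings

toℚᵘ-ℕ→ℚ : ∀ n → toℚᵘ (ℕ→ℚ n) ℚᵘ.≃ mkℚᵘ (ℤ.+ n) 0
toℚᵘ-ℕ→ℚ n = ℚ.toℚᵘ-fromℚᵘ (mkℚᵘ (ℤ.+ n) 0)

ℕ→ℚ-+ : ∀ m n → ℕ→ℚ (m ℕ.+ n) ≡ ℕ→ℚ m ℚ.+ ℕ→ℚ n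
ℕ→ℚ-+ m n = ℚ.toℚᵘ-injective (begin-equality
  toℚᵘ (ℕ→ℚ (m ℕ.+ n))                 ≃⟨ toℚᵘ-ℕ→ℚ (m ℕ.+ n) ⟩
  mkℚᵘ (ℤ.+ (m ℕ.+ n)) 0                 ≃⟨ *≡* (cong₂ (λ a b → (a ℤ.+ b) ℤ.* ℤ.+ 1) (sym (ℤ.*-identityʳ (ℤ.+ m))) (sym (ℤ.*-identityʳ (ℤ.+ n)))) ⟩
  mkℚᵘ (ℤ.+ m) 0 ℚᵘ.+ mkℚᵘ (ℤ.+ n) 0       ≃⟨ ℚᵘ.+-cong (toℚᵘ-ℕ→ℚ m) (toℚᵘ-ℕ→ℚ n) ⟨
  toℚᵘ (ℕ→ℚ m) ℚᵘ.+ toℚᵘ (ℕ→ℚ n)       ≃⟨ ℚ.toℚᵘ-homo-+ (ℕ→ℚ m) (ℕ→ℚ n) ⟨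
  toℚᵘ (ℕ→ℚ m ℚ.+ ℕ→ℚ n)               ∎)
  where open ℚᵘ.≤-Reasoning

ℕ→ℚ-* : ∀ m n → ℕ→ℚ (m ℕ.* n) ≡ ℕ→ℚ m ℚ.* ℕ→ℚ n
ℕ→ℚ-* m n = ℚ.toℚᵘ-injective (begin-equality
  toℚᵘ (ℕ→ℚ (m ℕ.* n))                 ≃⟨ toℚᵘ-ℕ→ℚ (m ℕ.* n) ⟩
  mkℚᵘ (ℤ.+ (m ℕ.* n)) 0                 ≃⟨ *≡* (cong (ℤ._* ℤ.+ 1) (ℤ.pos-* m n)) ⟩
  mkℚᵘ (ℤ.+ m) 0 ℚᵘ.* mkℚᵘ (ℤ.+ n) 0       ≃⟨ ℚᵘ.*-cong (toℚᵘ-ℕ→ℚ m) (toℚᵘ-ℕ→ℚ n) ⟨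
  toℚᵘ (ℕ→ℚ m) ℚᵘ.* toℚᵘ (ℕ→ℚ n)       ≃⟨ ℚ.toℚᵘ-homo-* (ℕ→ℚ m) (ℕ→ℚ n) ⟨
  toℚᵘ (ℕ→ℚ m ℚ.* ℕ→ℚ n)               ∎)
  where open ℚᵘ.≤-Reasoning

ℕ→ℚ-mono-≤ : ∀ {m n} → m ℕ.≤ n → ℕ→ℚ m ℚ.≤ ℕ→ℚ n
ℕ→ℚ-mono-≤ {m} {n} m≤n = ℚ.toℚᵘ-cancel-≤ (begin
  toℚᵘ (ℕ→ℚ m)  ≃⟨ toℚᵘ-ℕ→ℚ m ⟩
  mkℚᵘ (ℤ.+ m) 0  ≤⟨ *≤* (ℤ.*-monoʳ-≤-nonNeg (ℤ.+ 1) (ℤ.+≤+ m≤n)) ⟩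
  mkℚᵘ (ℤ.+ n) 0  ≃⟨ toℚᵘ-ℕ→ℚ n ⟨
  toℚᵘ (ℕ→ℚ n)  ∎)
  where open ℚᵘ.≤-Reasoning

ℕ→ℚ-mono-< : ∀ {m n} → m ℕ.< n → ℕ→ℚ m ℚ.< ℕ→ℚ n
ℕ→ℚ-mono-< {m} {n} m<n = ℚ.toℚᵘ-cancel-< (begin-strict
  toℚᵘ (ℕ→ℚ m)  ≃⟨ toℚᵘ-ℕ→ℚ m ⟩
  mkℚᵘ (ℤ.+ m) 0  <⟨ *<* (ℤ.*-monoʳ-<-pos (ℤ.+ 1) (ℤ.+<+ m<n)) ⟩
  mkℚᵘ (ℤ.+ n) 0  ≃⟨ toℚᵘ-ℕ→ℚ n ⟨
  toℚᵘ (ℕ→ℚ n)  ∎)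
  where open ℚᵘ.≤-Reasoning

ℕ→ℚ-cancel-≤ : ∀ {m n} → ℕ→ℚ m ℚ.≤ ℕ→ℚ n → m ℕ.≤ n
ℕ→ℚ-cancel-≤ {m} {n} le = ℕ.≮⇒≥ λ n<m → ℚ.<-irrefl refl (ℚ.<-≤-trans (ℕ→ℚ-mono-< {n} {m} n<m) le)

0≤ℕ→ℚ : ∀ n → 0ℚ ℚ.≤ ℕ→ℚ n
0≤ℕ→ℚ n = ℕ→ℚ-mono-≤ {0} {n} z≤n

*-mono-≤-nonNeg : ∀ {p q r s} → 0ℚ ℚ.≤ r → 0ℚ ℚ.≤ q → p ℚ.≤ q → r ℚ.≤ s → p ℚ.* r ℚ.≤ q ℚ.* s
*-mono-≤-nonNeg {p} {q} {r} {s} 0≤r 0≤q p≤q r≤s = ℚ.≤-trans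
  (ℚ.*-monoʳ-≤-nonNeg r {{ℚ.nonNegative 0≤r}} p≤q) (ℚ.*-monoˡ-≤-nonNeg q {{ℚ.nonNegative 0≤q}} r≤s)

^ℚ-lower : ∀ {p} q k → ℕ→ℚ q ℚ.≤ p → ℕ→ℚ (q ℕ.^ k) ℚ.≤ p ^ℚ k
^ℚ-lower q zero    q≤p = ℚ.≤-refl
^ℚ-lower q (suc k) q≤p = subst (ℚ._≤ _) (sym (ℕ→ℚ-* q (q ℕ.^ k)))
  (*-mono-≤-nonNeg (0≤ℕ→ℚ (q ℕ.^ k)) (ℚ.≤-trans (0≤ℕ→ℚ q) q≤p) q≤p (^ℚ-lower q k q≤p))

private
  -- `ceiling` is the negated floor of the negation, so the ceiling of (a + 1)/d comes from dividing
  -- -(a + 1) by d. A quotient -(q + 1) stands for the ceiling q + 1, and negation swaps the two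
  -- bounds of the division.
  from-neg : ∀ a q d → -[1+ q ] ℤ.* ℤ.+ d ℤ.≤ -[1+ a ] → -[1+ a ] ℤ.< ℤ.suc -[1+ q ] ℤ.* ℤ.+ d →
             (q ℕ.* d ℕ.< suc a) × (suc a ℕ.≤ suc q ℕ.* d)
  from-neg a q d lo hi = ℤ.drop‿+<+ (ℤ.neg-cancel-< (subst (ℤ.- (ℤ.+ suc a) ℤ.<_) eq₂ hi))
                       , ℤ.drop‿+≤+ (ℤ.neg-cancel-≤ (subst (ℤ._≤ ℤ.- (ℤ.+ suc a)) eq₁ lo))
    where
    eq₁ : -[1+ q ] ℤ.* ℤ.+ d ≡ ℤ.- (ℤ.+ (suc q ℕ.* d))
    eq₁ = trans (sym (ℤ.neg-distribˡ-* (ℤ.+ suc q) (ℤ.+ d))) (cong ℤ.-_ (sym (ℤ.pos-* (suc q) d)))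
    eq₂ : ℤ.suc -[1+ q ] ℤ.* ℤ.+ d ≡ ℤ.- (ℤ.+ (q ℕ.* d))
    eq₂ = trans (cong (ℤ._* ℤ.+ d) (suc-neg q)) (trans (sym (ℤ.neg-distribˡ-* (ℤ.+ q) (ℤ.+ d))) (cong ℤ.-_ (sym (ℤ.pos-* q d))))
      where
      suc-neg : ∀ q → ℤ.suc -[1+ q ] ≡ ℤ.- (ℤ.+ q)
      suc-neg zero    = refl
      suc-neg (suc q) = refl

ceilℕ-bounds : ∀ p → 0ℚ ℚ.< p → ∃ λ q → ceilℕ p ≡ suc q × ℕ→ℚ q ℚ.< p × p ℚ.≤ ℕ→ℚ (suc q)
ceilℕ-bounds (mkℚ (ℤ.+ zero) d-1 c) (*<* (ℤ.+<+ ()))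
ceilℕ-bounds (mkℚ -[1+ a ] d-1 c) (*<* ())
ceilℕ-bounds p@(mkℚ (ℤ.+ suc a) d-1 c) _ with -[1+ a ] ℤ./ (ℤ.+ suc d-1) in eq
... | f with subst (λ f → f ℤ.* ℤ.+ suc d-1 ℤ.≤ -[1+ a ]) eq (ℤ.[n/d]*d≤n -[1+ a ] (ℤ.+ suc d-1))
           | subst (λ f → -[1+ a ] ℤ.< ℤ.suc f ℤ.* ℤ.+ suc d-1) (trans (sym (ℤ.div-pos-is-/ℕ -[1+ a ] (suc d-1))) eq) (ℤ.n<s[n/ℕd]*d -[1+ a ] (suc d-1))
-- A nonnegative quotient is impossible: its product with the positive divisor would be at most a
-- negative number.
ceilℕ-bounds p@(mkℚ (ℤ.+ suc a) d-1 c) _ | ℤ.+ n | lo | hi with subst (ℤ._≤ -[1+ a ]) (sym (ℤ.pos-* n (suc d-1))) lo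
... | ()
ceilℕ-bounds p@(mkℚ (ℤ.+ suc a) d-1 c) _ | -[1+ q ] | lo | hi = q , refl , below , above
  where
  open ℚᵘ.≤-Reasoning
  bnd = from-neg a q (suc d-1) lo hi
  below : ℕ→ℚ q ℚ.< p
  below = ℚ.toℚᵘ-cancel-< (begin-strict
    toℚᵘ (ℕ→ℚ q)           ≃⟨ toℚᵘ-ℕ→ℚ q ⟩
    mkℚᵘ (ℤ.+ q) 0           <⟨ *<* (subst₂ ℤ._<_ (ℤ.pos-* q (suc d-1)) (sym (ℤ.*-identityʳ (ℤ.+ suc a))) (ℤ.+<+ (proj₁ bnd))) ⟩
    mkℚᵘ (ℤ.+ suc a) d-1     ∎)
  above : p ℚ.≤ ℕ→ℚ (suc q)
  above = ℚ.toℚᵘ-cancel-≤ (begin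
    mkℚᵘ (ℤ.+ suc a) d-1     ≤⟨ *≤* (subst₂ ℤ._≤_ (sym (ℤ.*-identityʳ (ℤ.+ suc a))) (ℤ.pos-* (suc q) (suc d-1)) (ℤ.+≤+ (proj₂ bnd))) ⟩
    mkℚᵘ (ℤ.+ suc q) 0       ≃⟨ toℚᵘ-ℕ→ℚ (suc q) ⟨
    toℚᵘ (ℕ→ℚ (suc q))     ∎)

module Combinatorics where
  open import Data.Nat
    using (_+_; _*_; _∸_; _^_; _/_; _%_; _⊓_; _≤_; _<_; _<ᵇ_; _≤ᵇ_; _≡ᵇ_; ∣_-_∣)

  -- Elimination orderings and minors

  abstract
    maximise : ∀ {n} {P : Fin n → Set} → Decidable P → (f : Fin n → ℕ) → ∃ P →
               ∃ λ v → P v × (∀ u → P u → f u ≤ f v)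
    maximise {n} P? f (v₀ , Pv₀) =
      Extrema.argmax f v₀ xs ,
      Extrema.argmax-all f Pv₀ (all-filter P? (allFin n)) ,
      λ u Pu → All.lookup (Extrema.f[xs]≤f[argmax] v₀ xs) (∈-filter⁺ P? (∈-allFin u) Pu)
      where
      xs : List (Fin n)
      xs = filter P? (allFin n)

    minimise : ∀ {n} (f : Fin n → ℕ) → Fin n → ∃ λ v → ∀ u → f v ≤ f u
    minimise {n} f v₀ = Extrema.argmin f v₀ (allFin n) ,
      λ u → All.lookup (Extrema.f[argmin]≤f[xs] v₀ (allFin n)) (∈-allFin u)

  -- An elimination ordering, given by ranks.  The region of t consists of the vertices
  -- connected to t through eliminated vertices, and its boundary of the vertices that are
  -- neighbours of t at the moment when t is eliminated.
  record Elimination (E : ℕ → ℕ → Set) (width : ℕ) : Set₁ where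
    field
      rank           : ℕ → ℕ
      Region         : ℕ → ℕ → Set
      boundary       : ℕ → List ℕ
      boundary-size  : ∀ t → length (boundary t) ≤ width
      region-self    : ∀ t → Region t t
      region-rank    : ∀ t {y} → Region t y → y ≡ t ⊎ rank y < rank t
      boundary-rank  : ∀ t {z} → z ∈ boundary t → rank t < rank z
      region-succ    : ∀ t {x y} → E x y → Region t x → Region t y ⊎ y ∈ boundary t
      region-pred    : ∀ t {x y} → E x y → Region t y → Region t x ⊎ x ∈ boundary t

  module _ {n : ℕ} (G : WGraph n) {E : ℕ → ℕ → Set} {width : ℕ}
           (adj⇒E : ∀ {u v} → adj G u v ≡ true → E (toℕ u) (toℕ v) ⊎ E (toℕ v) (toℕ u))
           (elim : Elimination E width) where
    open Elimination elim

    private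
      step : ∀ t {u v} → adj G u v ≡ true → Region t (toℕ u) → Region t (toℕ v) ⊎ toℕ v ∈ boundary t
      step t uv ru with adj⇒E uv
      ... | inj₁ e = region-succ t e ru
      ... | inj₂ e = region-pred t e ru

      -- The first vertex of the walk outside the region is a boundary vertex, and it satisfies `P`
      -- because the whole walk does.
      leave : ∀ t {P : Fin n → Set} {u v} (p : Walk (adj G) u v) → WalkIn P p → Region t (toℕ u) →
              Region t (toℕ v) ⊎ (∃ λ z → P z × toℕ z ∈ boundary t)
      leave t [] _ ru = inj₁ ru
      leave t (uv ∷ p) (_ ∷ inP) ru with step t uv ru
      ... | inj₁ rv = leave t p inP rv
      -- `WalkIn` stores the property of the first vertex of a walk, so the rest of the walk is
      -- split to read off `P` at the vertex just reached.
      leave t (uv ∷ []) (_ ∷ ([] Pv)) ru | inj₂ v∈ = inj₂ (_ , Pv , v∈)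
      leave t (uv ∷ (_ ∷ _)) (_ ∷ (Pv ∷ _)) ru | inj₂ v∈ = inj₂ (_ , Pv , v∈)

    -- Take the branch set whose vertex t of largest rank is smallest: every other branch
    -- set meets the boundary of t.
    elimination⇒¬HasMinor : ∀ {r} → suc width < r → ¬ HasMinor G r
    elimination⇒¬HasMinor {suc r} width<r (β , nonempty , connected , touching) =
      let (i , j , i<j , same) = Fin.pigeonhole (ℕ.≤-<-trans (s≤s (boundary-size t)) width<r) slot in
      Fin.<⇒≢ i<j (slot-injective i j same)
      where
      top : ∀ i → ∃ λ v → β v ≡ just i × (∀ u → β u ≡ just i → rank (toℕ u) ≤ rank (toℕ v))
      top i = maximise (λ v → Maybe.≡-dec Fin._≟_ (β v) (just i)) (λ v → rank (toℕ v)) (nonempty i)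
      rankTop : Fin (suc r) → ℕ
      rankTop i = rank (toℕ (proj₁ (top i)))
      lowest = minimise rankTop Fin.zero
      i₀ = proj₁ lowest
      v₀ = proj₁ (top i₀)
      t = toℕ v₀

      hit : ∀ j → j ≢ i₀ → ∃ λ z → β z ≡ just j × toℕ z ∈ boundary t
      hit j j≢i₀ with touching i₀ j (λ e → j≢i₀ (sym e))
      ... | u , v , βu , βv , uv with connected i₀ v₀ u (proj₁ (proj₂ (top i₀))) βu
      ...   | p , inP with leave t p inP (region-self t)
      -- Inside branch set `i₀` the walk cannot meet the boundary, since boundary vertices outrank
      -- t, the top of `i₀`.
      ...     | inj₂ (z , βz , z∈) = ⊥-elim (ℕ.<⇒≱ (boundary-rank t z∈) (proj₂ (proj₂ (top i₀)) z βz))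
      ...     | inj₁ ru with step t uv ru
      ...       | inj₂ v∈ = v , βv , v∈
      -- Branch set j enters the region of t. If the walk from there to the top of j stayed in the
      -- region, that top would be t itself or rank below t, against the choice of `i₀`.
      ...       | inj₁ rv with connected j v (proj₁ (top j)) βv (proj₁ (proj₂ (top j)))
      ...         | p′ , inP′ with leave t p′ inP′ rv
      ...           | inj₂ found = found
      ...           | inj₁ rw with region-rank t rw
      ...             | inj₁ w≡t = ⊥-elim (j≢i₀ (Maybe.just-injective
                            (trans (sym (proj₁ (proj₂ (top j)))) (trans (cong β (Fin.toℕ-injective w≡t)) (proj₁ (proj₂ (top i₀)))))))
      ...             | inj₂ lt = ⊥-elim (ℕ.<⇒≱ lt (proj₂ lowest j))

      -- Place zero is reserved for `i₀`, and every other branch set takes the place of a boundary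
      -- vertex that it meets. Disjointness makes this injective, so there are at most `suc width`
      -- branch sets.
      slot : Fin (suc r) → Fin (suc (length (boundary t)))
      slot j with j Fin.≟ i₀
      ... | yes _ = Fin.zero
      ... | no j≢i₀ = Fin.suc (index (proj₂ (proj₂ (hit j j≢i₀))))

      slot-injective : ∀ i j → slot i ≡ slot j → i ≡ j
      slot-injective i j e with i Fin.≟ i₀ | j Fin.≟ i₀
      ... | yes i≡ | yes j≡ = trans i≡ (sym j≡)
      slot-injective i j () | yes _ | no _
      slot-injective i j () | no _ | yes _
      slot-injective i j e | no i≢ | no j≢ with hit i i≢ | hit j j≢
      ... | z , βz , z∈ | z′ , βz′ , z′∈ = Maybe.just-injective (trans (sym βz) (trans (cong β z≡z′) βz′))
        where
        z≡z′ : z ≡ z′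
        z≡z′ = Fin.toℕ-injective (trans (lookup-index z∈)
          (trans (cong (List.lookup (boundary t)) (Fin.suc-injective e)) (sym (lookup-index z′∈))))

  -- Paths with chords

  ∑ : ℕ → (ℕ → ℕ) → ℕ
  ∑ zero    f = 0
  ∑ (suc n) f = f 0 + ∑ n (f ∘ suc)

  𝟙 : Bool → ℕ
  𝟙 b = if b then 1 else 0

  ∑-cong : ∀ n {f g} → (∀ x → f x ≡ g x) → ∑ n f ≡ ∑ n g
  ∑-cong zero    e = refl
  ∑-cong (suc n) e = cong₂ _+_ (e 0) (∑-cong n (e ∘ suc))

  sum-tabulate : ∀ n g → sum (List.tabulate {n = n} (g ∘ toℕ)) ≡ ∑ n g
  sum-tabulate zero    g = refl
  sum-tabulate (suc n) g = cong (g 0 +_) (sum-tabulate n (g ∘ suc))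

  sum-allFin : ∀ n g → sum (map (g ∘ toℕ) (allFin n)) ≡ ∑ n g
  sum-allFin n g = trans (cong sum (List.map-tabulate {n = n} id (g ∘ toℕ))) (sum-tabulate n g)

  sumℚ-ℕ→ℚ : ∀ {A : Set} (f : A → ℕ) xs → sumℚ (map (λ x → ℕ→ℚ (f x)) xs) ≡ ℕ→ℚ (sum (map f xs))
  sumℚ-ℕ→ℚ f []       = refl
  sumℚ-ℕ→ℚ f (x ∷ xs) = trans (cong (ℕ→ℚ (f x) ℚ.+_) (sumℚ-ℕ→ℚ f xs)) (sym (ℕ→ℚ-+ (f x) (sum (map f xs))))

  sumℚ-allFin : ∀ n g → sumℚ (map (λ i → ℕ→ℚ (g (toℕ i))) (allFin n)) ≡ ℕ→ℚ (∑ n g)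
  sumℚ-allFin n g = trans (sumℚ-ℕ→ℚ (g ∘ toℕ) (allFin n)) (cong ℕ→ℚ (sum-allFin n g))

  sumℚ-mono : ∀ {A : Set} {f g : A → ℚ} → (∀ x → f x ℚ.≤ g x) → ∀ xs → sumℚ (map f xs) ℚ.≤ sumℚ (map g xs)
  sumℚ-mono f≤g []       = ℚ.≤-refl
  sumℚ-mono f≤g (x ∷ xs) = ℚ.+-mono-≤ (f≤g x) (sumℚ-mono f≤g xs)

  sumℚ-allFin² : ∀ n (F : ℕ → ℕ → ℕ) →
    sumℚ (map (λ i → sumℚ (map (λ j → ℕ→ℚ (F (toℕ i) (toℕ j))) (allFin n))) (allFin n)) ≡ ℕ→ℚ (∑ n λ x → ∑ n (F x))
  sumℚ-allFin² n F = trans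
    (cong sumℚ (List.map-cong (λ i → sumℚ-allFin n (F (toℕ i))) (allFin n)))
    (sumℚ-allFin n (λ x → ∑ n (F x)))

  length-filter : ∀ {A : Set} (b : A → Bool) xs → length (filter (λ x → T? (b x)) xs) ≡ sum (map (𝟙 ∘ b) xs)
  length-filter b []       = refl
  length-filter b (x ∷ xs) with b x
  ... | true  = cong suc (length-filter b xs)
  ... | false = length-filter b xs

  ∑-𝟙≡ : ∀ n a → ∑ n (λ y → 𝟙 (y ≡ᵇ a)) ≡ 𝟙 (a <ᵇ n)
  ∑-𝟙≡ zero    a       = refl
  ∑-𝟙≡ (suc n) zero    = cong suc (none n)
    where
    none : ∀ n → ∑ n (λ _ → 0) ≡ 0
    none zero    = refl
    none (suc n) = none n
  ∑-𝟙≡ (suc n) (suc a) = ∑-𝟙≡ n a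

  ∑-𝟙suc< : ∀ n → ∑ n (λ x → 𝟙 (suc x <ᵇ n)) ≡ n ∸ 1
  ∑-𝟙suc< zero    = refl
  ∑-𝟙suc< (suc n) = below n
    where
    below : ∀ n → ∑ (suc n) (λ x → 𝟙 (x <ᵇ n)) ≡ n
    below zero    = refl
    below (suc n) = cong suc (below n)

  ≡ᵇ-true : ∀ {x y} → x ≡ y → (x ≡ᵇ y) ≡ true
  ≡ᵇ-true {x} refl = Equivalence.to Bool.T-≡ (ℕ.≡⇒≡ᵇ x x refl)

  true-≡ᵇ : ∀ {x y} → (x ≡ᵇ y) ≡ true → x ≡ y
  true-≡ᵇ {x} {y} e = ℕ.≡ᵇ⇒≡ x y (subst T (sym e) tt)

  ≡ᵇ-false : ∀ {x y} → x ≢ y → (x ≡ᵇ y) ≡ false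
  ≡ᵇ-false x≢y = Bool.¬-not (x≢y ∘ true-≡ᵇ)

  <ᵇ-true : ∀ {x y} → x < y → (x <ᵇ y) ≡ true
  <ᵇ-true {x} {y} lt with x <ᵇ y | ℕ.<⇒<ᵇ lt
  ... | true | _ = refl

  true-<ᵇ : ∀ {x y} → (x <ᵇ y) ≡ true → x < y
  true-<ᵇ {x} {y} e = ℕ.<ᵇ⇒< x y (subst T (sym e) tt)

  ∨-true : ∀ {a b} → a ∨ b ≡ true → a ≡ true ⊎ b ≡ true
  ∨-true {true}  _ = inj₁ refl
  ∨-true {false} e = inj₂ e

  PathEdges : ∀ n → EdgeSet n
  PathEdges n u v = (toℕ v ≡ᵇ suc (toℕ u)) ∨ (toℕ u ≡ᵇ suc (toℕ v))

  path-walk-up : ∀ {n} d (u v : Fin n) → toℕ v ≡ d + toℕ u → Walk (PathEdges n) u v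
  path-walk-up zero    u v e = subst (Walk _ u) (Fin.toℕ-injective (sym e)) []
  path-walk-up {n} (suc d) u v e = first ∷ path-walk-up d u′ v (trans e (trans (sym (ℕ.+-suc d (toℕ u))) (cong (d +_) (sym toℕ-u′))))
    where
    su<n : suc (toℕ u) < n
    su<n = ℕ.≤-<-trans (ℕ.≤-trans (s≤s (ℕ.m≤n+m (toℕ u) d)) (ℕ.≤-reflexive (sym e))) (Fin.toℕ<n v)
    u′ : Fin n
    u′ = fromℕ< su<n
    toℕ-u′ : toℕ u′ ≡ suc (toℕ u)
    toℕ-u′ = Fin.toℕ-fromℕ< su<n
    first : PathEdges n u u′ ≡ true
    first rewrite ≡ᵇ-true toℕ-u′ = refl

  path-walk-down : ∀ {n} d (u v : Fin n) → toℕ v ≡ d + toℕ u → Walk (PathEdges n) v u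
  path-walk-down zero    u v e = subst (Walk _ v) (Fin.toℕ-injective e) []
  path-walk-down {n} (suc d) u v e = first ∷ path-walk-down d u v′ toℕ-v′
    where
    lt : d + toℕ u < n
    lt = ℕ.≤-trans (ℕ.≤-reflexive (sym e)) (ℕ.<⇒≤ (Fin.toℕ<n v))
    v′ : Fin n
    v′ = fromℕ< lt
    toℕ-v′ : toℕ v′ ≡ d + toℕ u
    toℕ-v′ = Fin.toℕ-fromℕ< lt
    first : PathEdges n v v′ ≡ true
    first rewrite ≡ᵇ-true (trans e (cong suc (sym toℕ-v′))) = Bool.∨-zeroʳ _

  path-connected : ∀ n → IsConnected (PathEdges n)
  path-connected n u v with ℕ.≤-total (toℕ u) (toℕ v)
  ... | inj₁ u≤v = path-walk-up (toℕ v ∸ toℕ u) u v (sym (ℕ.m∸n+n≡m u≤v))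
  ... | inj₂ v≤u = path-walk-down (toℕ u ∸ toℕ v) v u (sym (ℕ.m∸n+n≡m v≤u))

  -- `totalWeight` and `edgeCount` run over pairs with i < j, where only the first disjunct can
  -- hold; each path edge is then counted once.
  path-upper : ∀ x y → ((x <ᵇ y) ∧ ((y ≡ᵇ suc x) ∨ (x ≡ᵇ suc y))) ≡ (y ≡ᵇ suc x)
  path-upper x y with y ≡ᵇ suc x in e
  ... | true rewrite true-≡ᵇ {y} {suc x} e = trans (Bool.∧-identityʳ (x <ᵇ suc x)) (<ᵇ-true (ℕ.n<1+n x))
  ... | false with x ≡ᵇ suc y in e′
  ...   | false = Bool.∧-zeroʳ (x <ᵇ y)
  ...   | true rewrite true-≡ᵇ {x} {suc y} e′ = trans (Bool.∧-identityʳ _) (Bool.¬-not (λ lt → ℕ.<-asym (true-<ᵇ {suc y} {y} lt) (ℕ.n<1+n y)))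

  ∑∑-path : ∀ n → ∑ n (λ x → ∑ n (λ y → 𝟙 (y ≡ᵇ suc x))) ≡ n ∸ 1
  ∑∑-path n = trans (∑-cong n (λ x → ∑-𝟙≡ n (suc x))) (∑-𝟙suc< n)

  path-edgeCount : ∀ n → edgeCount (PathEdges n) ≡ n ∸ 1
  path-edgeCount n = begin
    edgeCount (PathEdges n)
      ≡⟨ cong sum (List.map-cong (λ i → trans (length-filter _ (allFin n))
           (trans (cong sum (List.map-cong (λ j → cong 𝟙 (path-upper (toℕ i) (toℕ j))) (allFin n)))
                  (sum-allFin n (λ y → 𝟙 (y ≡ᵇ suc (toℕ i)))))) (allFin n)) ⟩
    sum (map (λ i → ∑ n (λ y → 𝟙 (y ≡ᵇ suc (toℕ i)))) (allFin n))
      ≡⟨ sum-allFin n (λ x → ∑ n (λ y → 𝟙 (y ≡ᵇ suc x))) ⟩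
    ∑ n (λ x → ∑ n (λ y → 𝟙 (y ≡ᵇ suc x)))
      ≡⟨ ∑∑-path n ⟩
    n ∸ 1 ∎
    where open ≡-Reasoning

  -- The weighted graph of a path with chords

  module ChordedPath (C : ℕ → ℕ → ℕ) (chord-long : ∀ {x y} → 0 < C x y → suc x < y) where

    -- `C x y` is the weight of the chord from x up to y, and zero encodes its absence. By
    -- `chord-long` at most one of the two summands is nonzero.
    up : ℕ → ℕ → ℕ
    up x y = 𝟙 (y ≡ᵇ suc x) + C x y

    weight : ℕ → ℕ → ℕ
    weight x y = up x y + up y x

    up-positive : ∀ {x y} → 0 < up x y → y ≡ suc x ⊎ 0 < C x y
    up-positive {x} {y} lt with y ≡ᵇ suc x in e
    ... | true  = inj₁ (true-≡ᵇ e)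
    ... | false = inj₂ lt

    C-short : ∀ {x y} → y ≤ suc x → C x y ≡ 0
    C-short {x} {y} le with C x y in e
    ... | zero  = refl
    ... | suc _ = ⊥-elim (ℕ.<⇒≱ (chord-long (subst (0 <_) (sym e) (s≤s z≤n))) le)

    up-zero : ∀ {x y} → y ≤ x → up x y ≡ 0
    up-zero {x} {y} le = cong₂ _+_ (cong 𝟙 (≡ᵇ-false {y} {suc x} (λ e → ℕ.<⇒≢ (s≤s le) e)))
                                   (C-short (ℕ.m≤n⇒m≤1+n le))

    weight-positive : ∀ {x y} → 0 < weight x y → 0 < up x y ⊎ 0 < up y x
    weight-positive {x} {y} lt with up x y
    ... | zero  = inj₂ lt
    ... | suc _ = inj₁ (s≤s z≤n)

    weight-upward : ∀ {x y} → x < y → weight x y ≡ up x y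
    weight-upward {x} {y} lt = trans (cong (up x y +_) (up-zero (ℕ.<⇒≤ lt))) (ℕ.+-identityʳ (up x y))

    weight-comm : ∀ x y → weight x y ≡ weight y x
    weight-comm x y = ℕ.+-comm (up x y) (up y x)

    weight-step : ∀ x y → y ≡ suc x → weight x y ≡ 1
    weight-step x _ refl = trans (weight-upward (ℕ.n<1+n x))
      (cong₂ _+_ (cong 𝟙 (≡ᵇ-true {suc x} refl)) (C-short ℕ.≤-refl))

    weight-chord : ∀ {x y} → 0 < C x y → weight x y ≡ C x y
    weight-chord {x} {y} pos = trans (weight-upward (ℕ.<⇒≤ long))
      (cong (λ b → 𝟙 b + C x y) (≡ᵇ-false {y} {suc x} (λ e → ℕ.<⇒≢ long (sym e))))
      where
      long : suc x < y
      long = chord-long pos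

    graph : ∀ n → WGraph n
    graph n .adj u v     = 0 <ᵇ weight (toℕ u) (toℕ v)
    graph n .wt u v      = ℕ→ℚ (weight (toℕ u) (toℕ v))
    graph n .adj-sym u v = cong (0 <ᵇ_) (weight-comm (toℕ u) (toℕ v))
    graph n .adj-irr u   = cong (0 <ᵇ_) (cong₂ _+_ (up-zero {toℕ u} ℕ.≤-refl) (up-zero {toℕ u} ℕ.≤-refl))
    graph n .wt-sym u v  = cong ℕ→ℚ (weight-comm (toℕ u) (toℕ v))
    graph n .wt-pos u v a = ℕ→ℚ-mono-< {0} {weight (toℕ u) (toℕ v)} (true-<ᵇ {0} a)

    path⊆graph : ∀ {n} (u v : Fin n) → PathEdges n u v ≡ true → adj (graph n) u v ≡ true
    path⊆graph u v e with ∨-true {toℕ v ≡ᵇ suc (toℕ u)} e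
    ... | inj₁ e₁ = cong (0 <ᵇ_) (weight-step (toℕ u) (toℕ v) (true-≡ᵇ e₁))
    ... | inj₂ e₂ = cong (0 <ᵇ_) (trans (weight-comm (toℕ u) (toℕ v)) (weight-step (toℕ v) (toℕ u) (true-≡ᵇ e₂)))

    graph-connected : ∀ n → IsConnected (adj (graph n))
    graph-connected n u v = embed (path-connected n u v)
      where
      embed : ∀ {u v} → Walk (PathEdges n) u v → Walk (adj (graph n)) u v
      embed []      = []
      embed (_∷_ {u} {v} e p) = path⊆graph u v e ∷ embed p

    path-isSpanningTree : ∀ n → IsSpanningTree (graph n) (PathEdges n)
    path-isSpanningTree n = ((λ u v → Bool.∨-comm (toℕ v ≡ᵇ suc (toℕ u)) (toℕ u ≡ᵇ suc (toℕ v))) , path⊆graph)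
                          , path-connected n , path-edgeCount n

    path-weight : ∀ n → totalWeight (graph n) (PathEdges n) ℚ.≤ ℕ→ℚ (n ∸ 1)
    path-weight n = ℚ.≤-trans (sumℚ-mono (λ i → sumℚ-mono (λ j → entry (toℕ i) (toℕ j)) (allFin n)) (allFin n))
      (ℚ.≤-reflexive (trans (sumℚ-allFin² n (λ x y → 𝟙 (y ≡ᵇ suc x))) (cong ℕ→ℚ (∑∑-path n))))
      where
      entry : ∀ x y → (if (x <ᵇ y) ∧ ((y ≡ᵇ suc x) ∨ (x ≡ᵇ suc y)) then ℕ→ℚ (weight x y) else 0ℚ) ℚ.≤ ℕ→ℚ (𝟙 (y ≡ᵇ suc x))
      entry x y rewrite path-upper x y = bound (y ≡ᵇ suc x) (λ e → weight-step x y (true-≡ᵇ {y} e))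
        where
        bound : ∀ b → (b ≡ true → weight x y ≡ 1) → (if b then ℕ→ℚ (weight x y) else 0ℚ) ℚ.≤ ℕ→ℚ (𝟙 b)
        bound false _ = ℚ.≤-refl
        bound true  e = ℚ.≤-reflexive (cong ℕ→ℚ (e refl))

    MST-weight : ∀ n T → IsMST (graph n) T → totalWeight (graph n) T ℚ.≤ ℕ→ℚ (n ∸ 1)
    MST-weight n T (_ , minimal) = ℚ.≤-trans (minimal (PathEdges n) (path-isSpanningTree n)) (path-weight n)

    -- A certificate that the distance of x₀ and y₀ without the chord x₀y₀ is at least
    -- (1 + 1/q) C(x₀,y₀): a potential that is Lipschitz along all other edges.
    Necessary : ℕ → ℕ → ℕ → Set
    Necessary q x₀ y₀ = ∃ λ (φ : ℕ → ℕ) →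
      (∀ x → ∣ φ x - φ (suc x) ∣ ≤ 1) ×
      (∀ x y → 0 < C x y → ¬ (x ≡ x₀ × y ≡ y₀) → ∣ φ x - φ y ∣ ≤ C x y) ×
      (q * φ x₀ + suc q * C x₀ y₀ ≤ q * φ y₀)

    -- Spanners contain all chords

    module _ {q : ℕ} {ε : ℚ} (qε<1 : ℕ→ℚ q ℚ.* ε ℚ.< 1ℚ) (necessary : ∀ x y → 0 < C x y → Necessary q x y) where

      -- If H omitted the chord, the potential φ would be Lipschitz along every walk in H, so each
      -- detour would weigh at least (1 + 1/q) w. The stretch allows only (1 + ε) w, which is
      -- smaller because q ε < 1. Both bounds are multiplied by q to stay free of fractions.
      spanner-chord : ∀ {n} {H : EdgeSet n} → IsSpanner (1ℚ ℚ.+ ε) (graph n) H →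
                      ∀ u v → 0 < C (toℕ u) (toℕ v) → H u v ≡ true
      spanner-chord {n} {H} ((H-sym , H⊆G) , stretch) u v pos with H u v in Huv
      ... | true  = refl
      ... | false = ⊥-elim (ℚ.<-irrefl refl (ℚ.<-≤-trans upper lower))
        where
        x₀ y₀ w : ℕ
        x₀ = toℕ u
        y₀ = toℕ v
        w = C x₀ y₀
        φ : ℕ → ℕ
        φ = proj₁ (necessary x₀ y₀ pos)
        lipschitz-path = proj₁ (proj₂ (necessary x₀ y₀ pos))
        lipschitz-chord = proj₁ (proj₂ (proj₂ (necessary x₀ y₀ pos)))
        gap = proj₂ (proj₂ (proj₂ (necessary x₀ y₀ pos)))

        lipschitz-up : ∀ {x y} → 0 < up x y → ¬ (x ≡ x₀ × y ≡ y₀) → ∣ φ x - φ y ∣ ≤ up x y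
        lipschitz-up {x} {y} pos′ other with up-positive {x} {y} pos′
        ... | inj₁ refl = ℕ.≤-trans (lipschitz-path x)
                (ℕ.≤-trans (ℕ.≤-reflexive (cong 𝟙 (sym (≡ᵇ-true {suc x} refl)))) (ℕ.m≤m+n (𝟙 (y ≡ᵇ suc x)) (C x y)))
        ... | inj₂ c    = ℕ.≤-trans (lipschitz-chord x y c other) (ℕ.m≤n+m (C x y) (𝟙 (y ≡ᵇ suc x)))

        lipschitz : ∀ {a b} → H a b ≡ true → φ (toℕ b) ≤ φ (toℕ a) + weight (toℕ a) (toℕ b)
        lipschitz {a} {b} Hab with weight-positive {toℕ a} {toℕ b} (true-<ᵇ {0} (H⊆G a b Hab))
        ... | inj₁ pos′ = ℕ.≤-trans (ℕ.m≤n+∣n-m∣ (φ (toℕ b)) (φ (toℕ a)))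
                (ℕ.+-monoʳ-≤ (φ (toℕ a)) (ℕ.≤-trans (lipschitz-up pos′ other) (ℕ.m≤m+n (up (toℕ a) (toℕ b)) _)))
          where
          other : ¬ (toℕ a ≡ x₀ × toℕ b ≡ y₀)
          other (ea , eb) with trans (sym Huv) (subst₂ (λ a b → H a b ≡ true) (Fin.toℕ-injective ea) (Fin.toℕ-injective eb) Hab)
          ... | ()
        ... | inj₂ pos′ = ℕ.≤-trans (ℕ.m≤n+∣m-n∣ (φ (toℕ b)) (φ (toℕ a)))
                (ℕ.+-monoʳ-≤ (φ (toℕ a)) (ℕ.≤-trans (lipschitz-up pos′ other) (ℕ.m≤n+m (up (toℕ b) (toℕ a)) (up (toℕ a) (toℕ b)))))
          where
          other : ¬ (toℕ b ≡ x₀ × toℕ a ≡ y₀)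
          other (eb , ea) with trans (sym Huv) (subst₂ (λ b a → H b a ≡ true) (Fin.toℕ-injective eb) (Fin.toℕ-injective ea) (trans (H-sym b a) Hab))
          ... | ()

        walk-lipschitz : ∀ {a b} (p : Walk H a b) → ℕ→ℚ (φ (toℕ b)) ℚ.≤ ℕ→ℚ (φ (toℕ a)) ℚ.+ walkWeight (graph n) p
        walk-lipschitz {a} [] = ℚ.≤-reflexive (sym (ℚ.+-identityʳ (ℕ→ℚ (φ (toℕ a)))))
        walk-lipschitz {a} {c} (_∷_ {v = b} e p) = begin
          ℕ→ℚ (φ (toℕ c))                                  ≤⟨ walk-lipschitz p ⟩
          ℕ→ℚ (φ (toℕ b)) ℚ.+ rest                         ≤⟨ ℚ.+-monoˡ-≤ rest (ℕ→ℚ-mono-≤ {φ (toℕ b)} {φ (toℕ a) + weight (toℕ a) (toℕ b)} (lipschitz e)) ⟩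
          ℕ→ℚ (φ (toℕ a) + weight (toℕ a) (toℕ b)) ℚ.+ rest ≡⟨ cong (ℚ._+ rest) (ℕ→ℚ-+ (φ (toℕ a)) (weight (toℕ a) (toℕ b))) ⟩
          (ℕ→ℚ (φ (toℕ a)) ℚ.+ wt (graph n) a b) ℚ.+ rest  ≡⟨ ℚ.+-assoc (ℕ→ℚ (φ (toℕ a))) (wt (graph n) a b) rest ⟩
          ℕ→ℚ (φ (toℕ a)) ℚ.+ (wt (graph n) a b ℚ.+ rest)  ∎
          where
          open ℚ.≤-Reasoning
          rest : ℚ
          rest = walkWeight (graph n) p

        edge : adj (graph n) u v ≡ true
        edge = <ᵇ-true {0} (subst (0 <_) (sym (weight-chord pos)) pos)

        -- The stretch is applied to the walk that consists of the chord alone.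
        detour = stretch u v (edge ∷ [])

        ℓ : ℚ
        ℓ = walkWeight (graph n) (proj₁ detour)

        ℓ-bound : ℓ ℚ.≤ (1ℚ ℚ.+ ε) ℚ.* ℕ→ℚ w
        ℓ-bound = ℚ.≤-trans (proj₂ detour) (ℚ.≤-reflexive (cong ((1ℚ ℚ.+ ε) ℚ.*_)
          (trans (ℚ.+-identityʳ _) (cong ℕ→ℚ (weight-chord pos)))))

        expand : ∀ Q A E w → Q ℚ.* (A ℚ.+ (1ℚ ℚ.+ E) ℚ.* w) ≡ Q ℚ.* A ℚ.+ (Q ℚ.* w ℚ.+ (Q ℚ.* E) ℚ.* w)
        expand Q A E w = trans (ℚ.*-distribˡ-+ Q A ((1ℚ ℚ.+ E) ℚ.* w)) (cong (Q ℚ.* A ℚ.+_)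
          (trans (cong (Q ℚ.*_) (trans (ℚ.*-distribʳ-+ w 1ℚ E) (cong (ℚ._+ E ℚ.* w) (ℚ.*-identityˡ w))))
          (trans (ℚ.*-distribˡ-+ Q w (E ℚ.* w)) (cong (Q ℚ.* w ℚ.+_) (sym (ℚ.*-assoc Q E w))))))

        open ℚ.≤-Reasoning

        upper : ℕ→ℚ (q * φ y₀) ℚ.< ℕ→ℚ (q * φ x₀ + suc q * w)
        upper = begin-strict
          ℕ→ℚ (q * φ y₀)                                    ≡⟨ ℕ→ℚ-* q (φ y₀) ⟩
          ℕ→ℚ q ℚ.* ℕ→ℚ (φ y₀)                              ≤⟨ ℚ.*-monoˡ-≤-nonNeg (ℕ→ℚ q) {{ℚ.nonNegative (0≤ℕ→ℚ q)}}
                                                                 (ℚ.≤-trans (walk-lipschitz (proj₁ detour)) (ℚ.+-monoʳ-≤ (ℕ→ℚ (φ x₀)) ℓ-bound)) ⟩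
          ℕ→ℚ q ℚ.* (ℕ→ℚ (φ x₀) ℚ.+ (1ℚ ℚ.+ ε) ℚ.* ℕ→ℚ w)   ≡⟨ expand (ℕ→ℚ q) (ℕ→ℚ (φ x₀)) ε (ℕ→ℚ w) ⟩
          ℕ→ℚ q ℚ.* ℕ→ℚ (φ x₀) ℚ.+ (ℕ→ℚ q ℚ.* ℕ→ℚ w ℚ.+ (ℕ→ℚ q ℚ.* ε) ℚ.* ℕ→ℚ w)
            -- The strict inequality arises here, from q ε < 1 and w > 0.
            <⟨ ℚ.+-monoʳ-< (ℕ→ℚ q ℚ.* ℕ→ℚ (φ x₀)) (ℚ.+-monoʳ-< (ℕ→ℚ q ℚ.* ℕ→ℚ w)
                 (ℚ.*-monoˡ-<-pos (ℕ→ℚ w) {{ℚ.positive (ℕ→ℚ-mono-< {0} {w} pos)}} qε<1)) ⟩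
          ℕ→ℚ q ℚ.* ℕ→ℚ (φ x₀) ℚ.+ (ℕ→ℚ q ℚ.* ℕ→ℚ w ℚ.+ 1ℚ ℚ.* ℕ→ℚ w)
            ≡⟨ cong₂ ℚ._+_ (sym (ℕ→ℚ-* q (φ x₀))) (trans (cong₂ ℚ._+_ (sym (ℕ→ℚ-* q w)) (ℚ.*-identityˡ (ℕ→ℚ w))) (sym (ℕ→ℚ-+ (q * w) w))) ⟩
          ℕ→ℚ (q * φ x₀) ℚ.+ ℕ→ℚ (q * w + w)                 ≡⟨ sym (ℕ→ℚ-+ (q * φ x₀) (q * w + w)) ⟩
          ℕ→ℚ (q * φ x₀ + (q * w + w))                       ≡⟨ cong (λ z → ℕ→ℚ (q * φ x₀ + z)) (ℕ.+-comm (q * w) w) ⟩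
          ℕ→ℚ (q * φ x₀ + suc q * w)                         ∎

        lower : ℕ→ℚ (q * φ x₀ + suc q * w) ℚ.≤ ℕ→ℚ (q * φ y₀)
        lower = ℕ→ℚ-mono-≤ {q * φ x₀ + suc q * w} {q * φ y₀} gap

      -- Pair by pair: a chord lies in H and contributes its full weight, and every other pair
      -- contributes at least zero.
      spanner-weight : ∀ {n} {H : EdgeSet n} → IsSpanner (1ℚ ℚ.+ ε) (graph n) H →
                       ℕ→ℚ (∑ n λ x → ∑ n (C x)) ℚ.≤ totalWeight (graph n) H
      spanner-weight {n} {H} sp = ℚ.≤-trans (ℚ.≤-reflexive (sym (sumℚ-allFin² n C)))
        (sumℚ-mono (λ i → sumℚ-mono (entry i) (allFin n)) (allFin n))
        where
        entry : ∀ i j → ℕ→ℚ (C (toℕ i) (toℕ j)) ℚ.≤ (if (toℕ i <ᵇ toℕ j) ∧ H i j then wt (graph n) i j else 0ℚ)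
        entry i j with 0 ℕ.<? C (toℕ i) (toℕ j)
        ... | yes pos rewrite <ᵇ-true (ℕ.<⇒≤ (chord-long pos)) | spanner-chord sp i j pos =
                ℚ.≤-reflexive (cong ℕ→ℚ (sym (weight-chord pos)))
        ... | no ¬pos = ℚ.≤-trans (ℚ.≤-reflexive (cong ℕ→ℚ (ℕ.n≤0⇒n≡0 (ℕ.≮⇒≥ ¬pos)))) (nonneg ((toℕ i <ᵇ toℕ j) ∧ H i j))
          where
          nonneg : ∀ b → 0ℚ ℚ.≤ (if b then wt (graph n) i j else 0ℚ)
          nonneg true  = 0≤ℕ→ℚ (weight (toℕ i) (toℕ j))
          nonneg false = ℚ.≤-refl

  -- Elimination orderings of the two constructions

  open Elimination

  Elimination-⊆ : ∀ {E F w v} → (∀ {x y} → E x y → F x y) → w ≤ v → Elimination F w → Elimination E v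
  Elimination-⊆ E⊆F w≤v elim = record
    { rank          = rank elim
    ; Region        = Region elim
    ; boundary      = boundary elim
    ; boundary-size = λ t → ℕ.≤-trans (boundary-size elim t) w≤v
    ; region-self   = region-self elim
    ; region-rank   = region-rank elim
    ; boundary-rank = boundary-rank elim
    ; region-succ   = λ t e → region-succ elim t (E⊆F e)
    ; region-pred   = λ t e → region-pred elim t (E⊆F e)
    }

  -- Eliminating from left to right cuts off the initial segment up to t. An edge leaving it spans
  -- at most b, so it ends among the next b vertices.
  bandwidth-elimination : ∀ b → Elimination (λ x y → x ≤ y × y ≤ x + b) b
  bandwidth-elimination b = record
    { rank          = λ t → t
    ; Region        = λ t y → y ≤ t
    ; boundary      = ahead
    ; boundary-size = λ t → ℕ.≤-reflexive (List.length-applyUpTo (suc t +_) b)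
    ; region-self   = λ t → ℕ.≤-refl
    ; region-rank   = λ t y≤t → Sum.swap (ℕ.m≤n⇒m<n∨m≡n y≤t)
    ; boundary-rank = λ t z∈ → later t (∈-applyUpTo⁻ (suc t +_) z∈)
    ; region-succ   = succ
    ; region-pred   = λ t (x≤y , _) y≤t → inj₁ (ℕ.≤-trans x≤y y≤t)
    }
    where
    ahead : ℕ → List ℕ
    ahead t = applyUpTo (suc t +_) b
    later : ∀ t {z} → (∃ λ i → i < b × z ≡ suc t + i) → t < z
    later t (i , _ , refl) = s≤s (ℕ.m≤m+n t i)
    succ : ∀ t {x y} → x ≤ y × y ≤ x + b → x ≤ t → y ≤ t ⊎ y ∈ ahead t
    succ t {x} {y} (_ , y≤x+b) x≤t with y ℕ.≤? t
    ... | yes y≤t = inj₁ y≤t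
    ... | no y≰t = inj₂ (subst (_∈ ahead t) (ℕ.m+[n∸m]≡n t<y) (∈-applyUpTo⁺ (suc t +_) i<b))
      where
      t<y : t < y
      t<y = ℕ.≰⇒> y≰t
      i<b : y ∸ suc t < b
      i<b = ℕ.+-cancelˡ-< (suc t) _ b (subst (_< suc t + b) (sym (ℕ.m+[n∸m]≡n t<y))
              (s≤s (ℕ.≤-trans y≤x+b (ℕ.+-monoˡ-≤ b x≤t))))

  -- A copy of depth m + 1 is a series of 2k copies of depth m with rungs i ↦ i + k between
  -- their ends; the scaled path edges are virtual edges joining the two ends of a copy.
  module Ladder (k-1 : ℕ) where
    k Q : ℕ
    k = suc k-1
    Q = k + k

    -- The recursion inserts the finest rungs last: from depth m to m + 1 all coordinates are
    -- multiplied by `Q`, and a ladder is put between any two consecutive multiples of `Q`.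
    data Edge : ℕ → ℕ → ℕ → Set where
      path  : ∀ {m x} → Edge m x (suc x)
      rung  : ∀ {m} a {i} → i < k → Edge (suc m) (a * Q + i) (a * Q + (i + k))
      scale : ∀ {m x y} → Edge m x y → Edge (suc m) (x * Q) (y * Q)

    offset-/ : ∀ a {i} → i < Q → (a * Q + i) / Q ≡ a
    offset-/ a {i} i<Q = trans (ℕ.+-distrib-/-∣ˡ {a * Q} i (ℕ.n∣m*n a))
      (trans (cong₂ _+_ (ℕ.m*n/n≡m a Q) (ℕ.m<n⇒m/n≡0 i<Q)) (ℕ.+-identityʳ a))

    offset-% : ∀ a {i} → i < Q → (a * Q + i) % Q ≡ i
    offset-% a {i} i<Q = trans (cong (_% Q) (ℕ.+-comm (a * Q) i)) (trans (ℕ.[m+kn]%n≡m%n i a Q) (ℕ.m<n⇒m%n≡m i<Q))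

    offset-unique : ∀ {a b i j} → i < Q → j < Q → a * Q + i ≡ b * Q + j → a ≡ b × i ≡ j
    offset-unique {a} {b} i<Q j<Q e =
      trans (sym (offset-/ a i<Q)) (trans (cong (_/ Q) e) (offset-/ b j<Q)) ,
      trans (sym (offset-% a i<Q)) (trans (cong (_% Q) e) (offset-% b j<Q))

    offset : ∀ t → t / Q * Q + t % Q ≡ t
    offset t = trans (ℕ.+-comm (t / Q * Q) (t % Q)) (sym (ℕ.m≡m%n+[m/n]*n t Q))

    0<Q : 0 < Q
    0<Q = s≤s z≤n

    k<Q : k < Q
    k<Q = ℕ.m<m+n k (s≤s z≤n)

    *Q-cancel-< : ∀ {a b i j} → j < Q → a * Q + i < b * Q + j → a ≤ b
    *Q-cancel-< {a} {b} {i} {j} j<Q lt = ℕ.≮⇒≥ λ b<a → ℕ.<-irrefl refl (ℕ.<-≤-trans lt (begin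
      b * Q + j   ≤⟨ ℕ.+-monoʳ-≤ (b * Q) (ℕ.<⇒≤ j<Q) ⟩
      b * Q + Q   ≡⟨ ℕ.+-comm (b * Q) Q ⟩
      suc b * Q   ≤⟨ ℕ.*-monoˡ-≤ Q b<a ⟩
      a * Q       ≤⟨ ℕ.m≤m+n (a * Q) i ⟩
      a * Q + i   ∎))
      where open ℕ.≤-Reasoning

    sucQ : ∀ a → suc a * Q ≡ a * Q + Q
    sucQ a = ℕ.+-comm Q (a * Q)

    -- Inside a copy with ends 0 and Q the order of elimination is
    -- 1, k+1, 2, k+2, …, k-1, 2k-1, k.
    ladderRank : ℕ → ℕ
    ladderRank i with ℕ.<-cmp i k
    ... | tri< _ _ _ = i + i
    ... | tri≈ _ _ _ = Q
    ... | tri> _ _ _ = suc ((i ∸ k) + (i ∸ k))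

    ladderRank-left : ∀ {i} → i < k → ladderRank i ≡ i + i
    ladderRank-left {i} i<k with ℕ.<-cmp i k
    ... | tri< _ _ _   = refl
    ... | tri≈ i≮k _ _ = ⊥-elim (i≮k i<k)
    ... | tri> i≮k _ _ = ⊥-elim (i≮k i<k)

    ladderRank-mid : ladderRank k ≡ Q
    ladderRank-mid with ℕ.<-cmp k k
    ... | tri< _ k≢k _ = ⊥-elim (k≢k refl)
    ... | tri≈ _ _ _   = refl
    ... | tri> _ k≢k _ = ⊥-elim (k≢k refl)

    ladderRank-right : ∀ {j} → 0 < j → ladderRank (k + j) ≡ suc (j + j)
    ladderRank-right {j} 0<j with ℕ.<-cmp (k + j) k
    ... | tri< lt _ _ = ⊥-elim (ℕ.<⇒≱ lt (ℕ.m≤m+n k j))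
    ... | tri≈ _ e _  = ⊥-elim (ℕ.<⇒≢ (ℕ.m<m+n k 0<j) (sym e))
    ... | tri> _ _ _  = cong (λ d → suc (d + d)) (ℕ.m+n∸m≡n k j)

    double-mono-< : ∀ {i j} → i < j → suc (i + i) < j + j
    double-mono-< {i} {j} i<j = ℕ.≤-trans (ℕ.≤-reflexive (cong suc (sym (ℕ.+-suc i i)))) (ℕ.+-mono-≤ i<j i<j)

    data Side : ℕ → Set where
      left  : ∀ {i} → 0 < i → i < k → Side i
      mid   : Side k
      right : ∀ {j} → 0 < j → j < k → Side (k + j)

    side : ∀ {i} → 0 < i → i < Q → Side i
    side {i} 0<i i<Q with ℕ.<-cmp i k
    ... | tri< i<k _ _  = left 0<i i<k
    ... | tri≈ _ refl _ = mid
    ... | tri> _ _ k<i  = subst Side (ℕ.m+[n∸m]≡n (ℕ.<⇒≤ k<i)) (right (ℕ.m<n⇒0<n∸m k<i)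
            (ℕ.+-cancelˡ-< k (i ∸ k) k (subst (_< Q) (sym (ℕ.m+[n∸m]≡n (ℕ.<⇒≤ k<i))) i<Q)))

    ladderRank≤Q : ∀ {i} → Side i → ladderRank i ≤ Q
    ladderRank≤Q (left _ i<k)  = ℕ.≤-trans (ℕ.≤-reflexive (ladderRank-left i<k)) (ℕ.+-mono-≤ (ℕ.<⇒≤ i<k) (ℕ.<⇒≤ i<k))
    ladderRank≤Q mid           = ℕ.≤-reflexive ladderRank-mid
    ladderRank≤Q (right 0<j j<k) = ℕ.≤-trans (ℕ.≤-reflexive (ladderRank-right 0<j)) (ℕ.<⇒≤ (double-mono-< j<k))

    -- The part of a copy cut off by the four vertices 0, α, k and k + β.
    Cut : ℕ → ℕ → ℕ → Set
    Cut α β o = o < α ⊎ (k < o × o < k + β)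

    corners : ℕ → ℕ → List ℕ
    corners α β = 0 ∷ α ∷ k ∷ (k + β) ∷ []

    -- The two halves are eliminated alternately, so an initial part of each is gone: the right half
    -- is one step behind when a left vertex goes, and level with the left half when a right vertex
    -- goes. The middle comes last.
    LadderRegion : ∀ {i} → Side i → ℕ → Set
    LadderRegion (left {i} _ _)  o = Cut (suc i) i o
    LadderRegion mid             o = ⊤
    LadderRegion (right {j} _ _) o = Cut (suc j) (suc j) o

    ladderBoundary : ∀ {i} → Side i → List ℕ
    ladderBoundary (left {i} _ _)  = corners (suc i) i
    ladderBoundary mid             = 0 ∷ Q ∷ []
    ladderBoundary (right {j} _ _) = corners (suc j) (suc j)

    Inside : (ℕ → Set) → ℕ → Set
    Inside R o = 0 < o × o < Q × R o

    -- Scaled edges join multiples of `Q`, so strictly between the ends of a ladder only path edges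
    -- and rungs have to be followed.
    record LadderClosed (R : ℕ → Set) (Z : List ℕ) : Set where
      field
        path-succ : ∀ {o} → Inside R o → Inside R (suc o) ⊎ suc o ∈ Z
        path-pred : ∀ {o} → Inside R (suc o) → Inside R o ⊎ o ∈ Z
        rung-succ : ∀ {o} → o < k → Inside R o → Inside R (o + k) ⊎ o + k ∈ Z
        rung-pred : ∀ {o} → o < k → Inside R (o + k) → Inside R o ⊎ o ∈ Z
    open LadderClosed

    -- A path edge can leave either of the two intervals only at its ends, which are corners. A rung
    -- from the left part lands in the right part or on k + β because α ≤ β + 1, and a rung back
    -- lands in the left part or on 0 because β ≤ α.
    Cut-closed : ∀ {α β} → α ≤ k → β ≤ k → β ≤ α → α ≤ suc β → LadderClosed (Cut α β) (corners α β)
    Cut-closed {α} {β} α≤k β≤k β≤α α≤1+β = record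
      { path-succ = λ { (_ , _ , inj₁ o<α) → low o<α ; (_ , _ , inj₂ (k<o , o<k+β)) → high (ℕ.m<n⇒m<1+n k<o) o<k+β }
      ; path-pred = λ { {zero} _ → inj₂ (here refl)
                      ; {suc o} (_ , so<Q , inj₁ lt) → inj₁ (s≤s z≤n , ℕ.<⇒≤ so<Q , inj₁ (ℕ.<⇒≤ lt))
                      ; {suc o} (_ , so<Q , inj₂ (k<so , lt)) → back (ℕ.m≤n⇒m<n∨m≡n (ℕ.≤-pred k<so)) so<Q lt }
      ; rung-succ = λ { {o} _ (0<o , _ , inj₁ o<α) → across (ℕ.m≤n⇒m<n∨m≡n (ℕ.≤-pred (ℕ.<-≤-trans o<α α≤1+β))) 0<o
                      ; o<k (_ , _ , inj₂ (k<o , _)) → ⊥-elim (ℕ.<-asym o<k k<o) }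
      ; rung-pred = λ { {zero} _ _ → inj₂ (here refl)
                      ; {suc o} _ (_ , _ , inj₁ lt) → ⊥-elim (ℕ.<⇒≱ lt (ℕ.≤-trans α≤k (ℕ.m≤n+m k (suc o))))
                      ; {suc o} so<k (_ , _ , inj₂ (_ , lt)) → inj₁ (s≤s z≤n , ℕ.<-trans so<k k<Q ,
                          inj₁ (ℕ.<-≤-trans (ℕ.+-cancelˡ-< k (suc o) β (subst (_< k + β) (ℕ.+-comm (suc o) k) lt)) β≤α)) }
      }
      where
      low : ∀ {o} → o < α → Inside (Cut α β) (suc o) ⊎ suc o ∈ corners α β
      low o<α with ℕ.m≤n⇒m<n∨m≡n o<α
      ... | inj₁ so<α = inj₁ (s≤s z≤n , ℕ.<-trans (ℕ.<-≤-trans so<α α≤k) k<Q , inj₁ so<α)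
      ... | inj₂ so≡α = inj₂ (there (here so≡α))
      high : ∀ {o} → k < o → o ≤ k + β → Inside (Cut α β) o ⊎ o ∈ corners α β
      high {o} k<o o≤k+β with ℕ.m≤n⇒m<n∨m≡n o≤k+β
      ... | inj₁ lt = inj₁ (ℕ.≤-<-trans z≤n k<o , ℕ.<-≤-trans lt (ℕ.+-monoʳ-≤ k β≤k) , inj₂ (k<o , lt))
      ... | inj₂ e  = inj₂ (there (there (there (here e))))
      back : ∀ {o} → k < suc o ⊎ k ≡ suc o → suc (suc o) < Q → suc (suc o) < k + β → Inside (Cut α β) (suc o) ⊎ suc o ∈ corners α β
      back (inj₁ k<so) sso<Q lt = inj₁ (s≤s z≤n , ℕ.<⇒≤ sso<Q , inj₂ (k<so , ℕ.<⇒≤ lt))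
      back (inj₂ k≡so) _     _  = inj₂ (there (there (here (sym k≡so))))
      across : ∀ {o} → o < β ⊎ o ≡ β → 0 < o → Inside (Cut α β) (o + k) ⊎ o + k ∈ corners α β
      across {o} lt 0<o = high (ℕ.m<n+m k 0<o) (ℕ.≤-trans (ℕ.≤-reflexive (ℕ.+-comm o k)) (ℕ.+-monoʳ-≤ k (Sum.[ ℕ.<⇒≤ , ℕ.≤-reflexive ]′ lt)))

    ladder-closed : ∀ {i} (s : Side i) → LadderClosed (LadderRegion s) (ladderBoundary s)
    ladder-closed (left _ i<k)  = Cut-closed i<k (ℕ.<⇒≤ i<k) (ℕ.n≤1+n _) ℕ.≤-refl
    ladder-closed (right _ j<k) = Cut-closed j<k j<k ℕ.≤-refl (ℕ.n≤1+n _)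
    ladder-closed mid           = record
      { path-succ = λ (_ , o<Q , _) → end (ℕ.m≤n⇒m<n∨m≡n o<Q)
      ; path-pred = λ { {zero} _ → inj₂ (here refl) ; {suc o} (_ , lt , _) → inj₁ (s≤s z≤n , ℕ.<⇒≤ lt , tt) }
      ; rung-succ = λ o<k (0<o , _) → inj₁ (ℕ.<-≤-trans 0<o (ℕ.m≤m+n _ k) , ℕ.+-monoˡ-< k o<k , tt)
      ; rung-pred = λ { {zero} _ _ → inj₂ (here refl) ; {suc o} so<k _ → inj₁ (s≤s z≤n , ℕ.<-trans so<k k<Q , tt) }
      }
      where
      end : ∀ {o} → suc o < Q ⊎ suc o ≡ Q → Inside (λ _ → ⊤) (suc o) ⊎ suc o ∈ (0 ∷ Q ∷ [])
      end (inj₁ lt) = inj₁ (s≤s z≤n , lt , tt)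
      end (inj₂ e)  = inj₂ (there (here e))

    ladderRegion-self : ∀ {i} (s : Side i) → LadderRegion s i
    ladderRegion-self (left _ _)      = inj₁ ℕ.≤-refl
    ladderRegion-self mid             = tt
    ladderRegion-self (right {j} 0<j _) = inj₂ (ℕ.m<m+n k 0<j , ℕ.+-monoʳ-< k (ℕ.n<1+n j))

    private
      left<left : ∀ {o i} → o < k → i < k → o < i → ladderRank o < ladderRank i
      left<left o<k i<k o<i = subst₂ _<_ (sym (ladderRank-left o<k)) (sym (ladderRank-left i<k)) (ℕ.+-mono-< o<i o<i)
      left<right : ∀ {o j} → o < k → 0 < j → o ≤ j → ladderRank o < ladderRank (k + j)
      left<right o<k 0<j o≤j = subst₂ _<_ (sym (ladderRank-left o<k)) (sym (ladderRank-right 0<j)) (s≤s (ℕ.+-mono-≤ o≤j o≤j))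
      right<left : ∀ {j i} → 0 < j → i < k → j < i → ladderRank (k + j) < ladderRank i
      right<left 0<j i<k j<i = subst₂ _<_ (sym (ladderRank-right 0<j)) (sym (ladderRank-left i<k)) (double-mono-< j<i)
      right<right : ∀ {j i} → 0 < j → j < i → ladderRank (k + j) < ladderRank (k + i)
      right<right 0<j j<i = subst₂ _<_ (sym (ladderRank-right 0<j)) (sym (ladderRank-right (ℕ.<-trans 0<j j<i))) (s≤s (ℕ.+-mono-< j<i j<i))
      left<mid : ∀ {o} → o < k → ladderRank o < ladderRank k
      left<mid o<k = subst₂ _<_ (sym (ladderRank-left o<k)) (sym ladderRank-mid) (ℕ.+-mono-< o<k o<k)
      right<mid : ∀ {j} → 0 < j → j < k → ladderRank (k + j) < ladderRank k
      right<mid 0<j j<k = subst₂ _<_ (sym (ladderRank-right 0<j)) (sym ladderRank-mid) (double-mono-< j<k)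

    ladderRegion-rank : ∀ {i o} (s : Side i) → Side o → LadderRegion s o → o ≡ i ⊎ ladderRank o < ladderRank i
    ladderRegion-rank (left _ i<k) (left _ o<k) (inj₁ o≤i) with ℕ.m≤n⇒m<n∨m≡n (ℕ.≤-pred o≤i)
    ... | inj₁ o<i = inj₂ (left<left o<k i<k o<i)
    ... | inj₂ o≡i = inj₁ o≡i
    ladderRegion-rank (left _ _) (left _ o<k) (inj₂ (k<o , _)) = ⊥-elim (ℕ.<-asym o<k k<o)
    ladderRegion-rank (left _ i<k) mid (inj₁ k≤i) = ⊥-elim (ℕ.<⇒≱ i<k (ℕ.≤-pred k≤i))
    ladderRegion-rank (left _ _) mid (inj₂ (k<k , _)) = ⊥-elim (ℕ.<-irrefl refl k<k)
    ladderRegion-rank (left _ i<k) (right {j} _ _) (inj₁ le) = ⊥-elim (ℕ.<⇒≱ i<k (ℕ.≤-trans (ℕ.m≤m+n k j) (ℕ.≤-pred le)))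
    ladderRegion-rank (left {i} _ i<k) (right {j} 0<j _) (inj₂ (_ , lt)) = inj₂ (right<left 0<j i<k (ℕ.+-cancelˡ-< k j i lt))
    ladderRegion-rank mid (left _ o<k)      _ = inj₂ (left<mid o<k)
    ladderRegion-rank mid mid               _ = inj₁ refl
    ladderRegion-rank mid (right 0<j j<k)   _ = inj₂ (right<mid 0<j j<k)
    ladderRegion-rank (right 0<j _) (left _ o<k) (inj₁ o≤j) = inj₂ (left<right o<k 0<j (ℕ.≤-pred o≤j))
    ladderRegion-rank (right _ _) (left _ o<k) (inj₂ (k<o , _)) = ⊥-elim (ℕ.<-asym o<k k<o)
    ladderRegion-rank (right _ j<k) mid (inj₁ k≤j) = ⊥-elim (ℕ.<⇒≱ j<k (ℕ.≤-pred k≤j))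
    ladderRegion-rank (right _ _) mid (inj₂ (k<k , _)) = ⊥-elim (ℕ.<-irrefl refl k<k)
    ladderRegion-rank (right _ j<k) (right {l} _ _) (inj₁ le) = ⊥-elim (ℕ.<⇒≱ j<k (ℕ.≤-trans (ℕ.m≤m+n k l) (ℕ.≤-pred le)))
    ladderRegion-rank (right {j} _ _) (right {l} 0<l _) (inj₂ (_ , lt)) with ℕ.m≤n⇒m<n∨m≡n (ℕ.≤-pred (ℕ.+-cancelˡ-< k l (suc j) lt))
    ... | inj₁ l<j = inj₂ (right<right 0<l l<j)
    ... | inj₂ l≡j = inj₁ (cong (k +_) l≡j)

    -- The ends 0 and `Q` are kept apart because they are scaled vertices, which `newRank` places
    -- above the interiors of all ladders.
    ladderBoundary-rank : ∀ {i z} (s : Side i) → z ∈ ladderBoundary s → z ≡ 0 ⊎ z ≡ Q ⊎ (0 < z × z < Q × ladderRank i < ladderRank z)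
    ladderBoundary-rank (left _ _) (here refl) = inj₁ refl
    ladderBoundary-rank (left {i} _ i<k) (there (here refl)) = inj₂ (inj₂ (s≤s z≤n , ℕ.≤-<-trans i<k k<Q , up (ℕ.m≤n⇒m<n∨m≡n i<k)))
      where
      up : suc i < k ⊎ suc i ≡ k → ladderRank i < ladderRank (suc i)
      up (inj₁ si<k) = left<left i<k si<k (ℕ.n<1+n i)
      up (inj₂ si≡k) = subst (λ z → ladderRank i < ladderRank z) (sym si≡k) (left<mid i<k)
    ladderBoundary-rank (left _ i<k) (there (there (here refl))) = inj₂ (inj₂ (s≤s z≤n , k<Q , left<mid i<k))
    ladderBoundary-rank (left {i} 0<i i<k) (there (there (there (here refl)))) =
      inj₂ (inj₂ (s≤s z≤n , ℕ.+-monoʳ-< k i<k , left<right i<k 0<i ℕ.≤-refl))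
    ladderBoundary-rank mid (here refl) = inj₁ refl
    ladderBoundary-rank mid (there (here refl)) = inj₂ (inj₁ refl)
    ladderBoundary-rank (right _ _) (here refl) = inj₁ refl
    ladderBoundary-rank (right {j} 0<j j<k) (there (here refl)) = inj₂ (inj₂ (s≤s z≤n , ℕ.≤-<-trans j<k k<Q , up (ℕ.m≤n⇒m<n∨m≡n j<k)))
      where
      up : suc j < k ⊎ suc j ≡ k → ladderRank (k + j) < ladderRank (suc j)
      up (inj₁ sj<k) = right<left 0<j sj<k (ℕ.n<1+n j)
      up (inj₂ sj≡k) = subst (λ z → ladderRank (k + j) < ladderRank z) (sym sj≡k) (right<mid 0<j j<k)
    ladderBoundary-rank (right 0<j j<k) (there (there (here refl))) = inj₂ (inj₂ (s≤s z≤n , k<Q , right<mid 0<j j<k))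
    ladderBoundary-rank (right {j} 0<j j<k) (there (there (there (here refl)))) with ℕ.m≤n⇒m<n∨m≡n j<k
    ... | inj₁ sj<k = inj₂ (inj₂ (s≤s z≤n , ℕ.+-monoʳ-< k sj<k , right<right 0<j (ℕ.n<1+n j)))
    -- For j + 1 = k the last corner is the end `Q` of the ladder.
    ... | inj₂ sj≡k = inj₂ (inj₁ (cong (k +_) sj≡k))

    ladderBoundary-size : ∀ {i} (s : Side i) → length (ladderBoundary s) ≤ 4
    ladderBoundary-size (left _ _)  = ℕ.≤-refl
    ladderBoundary-size mid         = s≤s (s≤s z≤n)
    ladderBoundary-size (right _ _) = ℕ.≤-refl

    -- Refining an elimination ordering by ladders

    module _ {m : ℕ} (elim : Elimination (Edge m) 4) where
      private
        Kind : ℕ → Set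
        Kind i = i ≡ 0 ⊎ Side i

        kind : ∀ {i} → i < Q → Kind i
        kind {zero}  _   = inj₁ refl
        kind {suc i} i<Q = inj₂ (side (s≤s z≤n) i<Q)

        -- Interiors of ladders go first, with ranks at most `Q`; multiples of `Q` follow in their
        -- inherited order. Inner vertices of different ladders may share a rank, because the region
        -- of an inner vertex stays within its ladder.
        rankOf : ℕ → ℕ → ℕ
        rankOf a zero    = suc Q + rank elim a
        rankOf a (suc i) = ladderRank (suc i)

        newRank : ℕ → ℕ
        newRank t = rankOf (t / Q) (t % Q)

        newRank-offset : ∀ a {i} → i < Q → newRank (a * Q + i) ≡ rankOf a i
        newRank-offset a i<Q = cong₂ rankOf (offset-/ a i<Q) (offset-% a i<Q)

        newRank-scaled : ∀ a → newRank (a * Q) ≡ suc Q + rank elim a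
        newRank-scaled a = trans (cong newRank (sym (ℕ.+-identityʳ (a * Q)))) (newRank-offset a 0<Q)

        newRank-ladder : ∀ a {i} → 0 < i → i < Q → newRank (a * Q + i) ≡ ladderRank i
        newRank-ladder a {suc i} _ i<Q = newRank-offset a i<Q

        -- The intervals of length Q around a scaled region.
        Around : ℕ → ℕ → Set
        Around a y = ∃ λ b → Region elim a b × y < b * Q + Q × b * Q < y + Q

        regionAt : ∀ a {i} → Kind i → ℕ → Set
        regionAt a (inj₁ _) y = Around a y
        regionAt a (inj₂ s) y = ∃ λ o → y ≡ a * Q + o × Inside (LadderRegion s) o

        boundaryAt : ∀ a {i} → Kind i → List ℕ
        boundaryAt a (inj₁ _) = map (_* Q) (boundary elim a)
        boundaryAt a (inj₂ s) = map (a * Q +_) (ladderBoundary s)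

        size-at : ∀ a {i} (κ : Kind i) → length (boundaryAt a κ) ≤ 4
        size-at a (inj₁ _) = ℕ.≤-trans (ℕ.≤-reflexive (List.length-map (_* Q) (boundary elim a))) (boundary-size elim a)
        size-at a (inj₂ s) = ℕ.≤-trans (ℕ.≤-reflexive (List.length-map (a * Q +_) (ladderBoundary s))) (ladderBoundary-size s)

        around-self : ∀ {a b} → Region elim a b → Around a (b * Q)
        around-self {b = b} rb = b , rb , ℕ.m<m+n (b * Q) 0<Q , ℕ.m<m+n (b * Q) 0<Q

        side-pos : ∀ {i} → Side i → 0 < i
        side-pos (left 0<i _)  = 0<i
        side-pos mid           = s≤s z≤n
        side-pos (right _ _)   = s≤s z≤n

        self-at : ∀ a {i} → i < Q → (κ : Kind i) → regionAt a κ (a * Q + i)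
        self-at a _ (inj₁ refl) = subst (Around a) (sym (ℕ.+-identityʳ (a * Q))) (around-self (region-self elim a))
        self-at a {i} i<Q (inj₂ s) = i , refl , side-pos s , i<Q , ladderRegion-self s

        around-scaled : ∀ {a c} → Around a (c * Q) → Region elim a c
        around-scaled {a} {c} (b , rb , lt₁ , lt₂) = subst (Region elim a) (ℕ.≤-antisym b≤c c≤b) rb
          where
          c≤b : c ≤ b
          c≤b = ℕ.≤-pred (ℕ.*-cancelʳ-< Q c (suc b) (subst (c * Q <_) (sym (sucQ b)) lt₁))
          b≤c : b ≤ c
          b≤c = ℕ.≤-pred (ℕ.*-cancelʳ-< Q b (suc c) (subst (b * Q <_) (sym (sucQ c)) lt₂))

        rank-at : ∀ a {i} → i < Q → (κ : Kind i) → ∀ {c j} → j < Q → regionAt a κ (c * Q + j) →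
                  c * Q + j ≡ a * Q + i ⊎ newRank (c * Q + j) < rankOf a i
        rank-at a _ (inj₁ refl) {c} {zero} _ around with region-rank elim a (around-scaled {a} {c} (subst (Around a) (ℕ.+-identityʳ (c * Q)) around))
        ... | inj₁ refl = inj₁ refl
        ... | inj₂ lt = inj₂ (subst (_< suc Q + rank elim a) (sym (newRank-offset c 0<Q)) (ℕ.+-monoʳ-< (suc Q) lt))
        rank-at a _ (inj₁ refl) {c} {suc j} j<Q _ = inj₂ (subst (_< suc Q + rank elim a) (sym (newRank-offset c j<Q))
          (s≤s (ℕ.≤-trans (ladderRank≤Q (side (s≤s z≤n) j<Q)) (ℕ.m≤m+n Q (rank elim a)))))
        rank-at a {zero} _ (inj₂ s) _ _ = ⊥-elim (ℕ.<-irrefl refl (side-pos s))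
        rank-at a {suc i} _ (inj₂ s) {c} {j} j<Q (o , e , 0<o , o<Q , r) with offset-unique {c} {a} j<Q o<Q e
        ... | refl , refl with ladderRegion-rank s (side 0<o o<Q) r
        ...   | inj₁ refl = inj₁ refl
        ...   | inj₂ lt = inj₂ (subst (_< ladderRank (suc i)) (sym (newRank-ladder c 0<o o<Q)) lt)

        scaled-high : ∀ {a i} b → Side i → rankOf a i < newRank (b * Q)
        scaled-high {i = zero}  b s = ⊥-elim (ℕ.<-irrefl refl (side-pos s))
        scaled-high {i = suc i} b s = subst (ladderRank (suc i) <_) (sym (newRank-scaled b))
          (s≤s (ℕ.≤-trans (ladderRank≤Q s) (ℕ.m≤m+n Q (rank elim b))))

        boundary-rank-at : ∀ a {i} (κ : Kind i) {z} → z ∈ boundaryAt a κ → rankOf a i < newRank z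
        boundary-rank-at a (inj₁ refl) z∈ with ∈-map⁻ (_* Q) z∈
        ... | c , c∈ , refl = subst (suc Q + rank elim a <_) (sym (newRank-scaled c)) (ℕ.+-monoʳ-< (suc Q) (boundary-rank elim a c∈))
        boundary-rank-at a {zero} (inj₂ s) _ = ⊥-elim (ℕ.<-irrefl refl (side-pos s))
        boundary-rank-at a {suc i} (inj₂ s) z∈ with ∈-map⁻ (a * Q +_) z∈
        ... | o , o∈ , refl with ladderBoundary-rank s o∈
        ...   | inj₁ refl = subst (λ z → ladderRank (suc i) < newRank z) (sym (ℕ.+-identityʳ (a * Q))) (scaled-high {a} a s)
        ...   | inj₂ (inj₁ refl) = subst (λ z → ladderRank (suc i) < newRank z) (sucQ a) (scaled-high {a} (suc a) s)
        ...   | inj₂ (inj₂ (0<o , o<Q , lt)) = subst (ladderRank (suc i) <_) (sym (newRank-ladder a 0<o o<Q)) lt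

        around-or : ∀ {a b y} → y ≡ b * Q → Region elim a b ⊎ b ∈ boundary elim a → Around a y ⊎ y ∈ map (_* Q) (boundary elim a)
        around-or refl (inj₁ rb) = inj₁ (around-self rb)
        around-or refl (inj₂ b∈) = inj₂ (∈-map⁺ (_* Q) b∈)

        inside-or : ∀ a {i} {s : Side i} {o y} → y ≡ a * Q + o → Inside (LadderRegion s) o ⊎ o ∈ ladderBoundary s →
                    regionAt a (inj₂ s) y ⊎ y ∈ boundaryAt a (inj₂ s)
        inside-or a e    (inj₁ r)  = inj₁ (_ , e , r)
        inside-or a refl (inj₂ o∈) = inj₂ (∈-map⁺ (a * Q +_) o∈)

        -- For a scaled vertex, a path edge can leave the union of intervals only at a multiple of
        -- `Q`, and this exit is governed by the virtual path edge of the coarse graph; rungs stay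
        -- within an interval, and scaled edges are edges of the coarse graph. For an inner vertex,
        -- `offset-unique` moves the edge into the ladder.
        succ-at : ∀ a {i} (κ : Kind i) {x y} → Edge (suc m) x y → regionAt a κ x → regionAt a κ y ⊎ y ∈ boundaryAt a κ
        succ-at a (inj₁ _) (path {x = x}) (b , rb , lt₁ , lt₂) with ℕ.m≤n⇒m<n∨m≡n lt₁
        ... | inj₁ lt = inj₁ (b , rb , lt , ℕ.m<n⇒m<1+n lt₂)
        ... | inj₂ e  = around-or (trans e (sym (sucQ b))) (region-succ elim a (path {x = b}) rb)
        succ-at a (inj₁ _) (rung c {i} i<k) (b , rb , lt₁ , lt₂) = inj₁ (b , rb ,
          ℕ.<-≤-trans (ℕ.+-monoʳ-< (c * Q) (ℕ.+-monoˡ-< k i<k)) (ℕ.+-monoˡ-≤ Q (ℕ.*-monoˡ-≤ Q c≤b)) ,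
          ℕ.<-≤-trans lt₂ (ℕ.+-monoˡ-≤ Q (ℕ.+-monoʳ-≤ (c * Q) (ℕ.m≤m+n i k))))
          where
          c≤b : c ≤ b
          c≤b = ℕ.≤-pred (ℕ.*-cancelʳ-< Q c (suc b) (ℕ.≤-<-trans (ℕ.m≤m+n (c * Q) i) (subst (c * Q + i <_) (sym (sucQ b)) lt₁)))
        succ-at a (inj₁ _) (scale {x = x} e) around = around-or refl (region-succ elim a e (around-scaled {a} {x} around))
        succ-at a (inj₂ s) path (o , e , r) = inside-or a (trans (cong suc e) (sym (ℕ.+-suc (a * Q) o))) (path-succ (ladder-closed s) r)
        succ-at a (inj₂ s) (rung c {i} i<k) (o , e , r@(_ , o<Q , _)) with offset-unique {c} {a} (ℕ.<-trans i<k k<Q) o<Q e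
        ... | refl , refl = inside-or c refl (rung-succ (ladder-closed s) i<k r)
        succ-at a (inj₂ s) (scale {x = x} _) (o , e , 0<o , o<Q , _) with offset-unique {x} {a} 0<Q o<Q (trans (ℕ.+-identityʳ (x * Q)) e)
        ... | _ , refl = ⊥-elim (ℕ.<-irrefl refl 0<o)

        pred-at : ∀ a {i} (κ : Kind i) {x y} → Edge (suc m) x y → regionAt a κ y → regionAt a κ x ⊎ x ∈ boundaryAt a κ
        pred-at a (inj₁ _) (path {x = x}) (b , rb , lt₁ , lt₂) with ℕ.m≤n⇒m<n∨m≡n (ℕ.≤-pred lt₂)
        ... | inj₁ lt = inj₁ (b , rb , ℕ.<⇒≤ lt₁ , lt)
        -- Here x = (b - 1) Q, so the virtual path edge from b - 1 to b decides.
        ... | inj₂ e with b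
        ...   | zero   = ⊥-elim (ℕ.<⇒≱ 0<Q (ℕ.≤-trans (ℕ.m≤n+m Q x) (ℕ.≤-reflexive (sym e))))
        ...   | suc b′ = around-or (ℕ.+-cancelʳ-≡ Q x (b′ * Q) (trans (sym e) (sucQ b′))) (region-pred elim a (path {x = b′}) rb)
        pred-at a (inj₁ _) (rung c {i} i<k) (b , rb , lt₁ , lt₂) with b ℕ.≤? c
        ... | yes b≤c = inj₁ (b , rb , lt-left , ℕ.≤-<-trans (ℕ.*-monoˡ-≤ Q b≤c) (ℕ.≤-<-trans (ℕ.m≤m+n (c * Q) i) (ℕ.m<m+n (c * Q + i) 0<Q)))
          where
          lt-left : c * Q + i < b * Q + Q
          lt-left = ℕ.≤-<-trans (ℕ.+-monoʳ-≤ (c * Q) (ℕ.m≤m+n i k)) lt₁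
        ... | no b≰c = last i refl
          where
          b≤1+c : b ≤ suc c
          b≤1+c = *Q-cancel-< {b} {suc c} {0} {i + k} (ℕ.+-monoˡ-< k i<k)
            (subst₂ _<_ (sym (ℕ.+-identityʳ (b * Q))) (trans (ℕ.+-assoc (c * Q) (i + k) Q) (trans (cong (c * Q +_) (ℕ.+-comm (i + k) Q)) (trans (sym (ℕ.+-assoc (c * Q) Q (i + k))) (cong (_+ (i + k)) (sym (sucQ c)))))) lt₂)
          b≡1+c : b ≡ suc c
          b≡1+c = ℕ.≤-antisym b≤1+c (ℕ.≰⇒> b≰c)
          -- With b = c + 1 the rung ends in the interval just before bQ. For i = 0 it starts at the
          -- scaled vertex cQ, which the virtual path edge from c to b handles; for i > 0 it starts
          -- less than `Q` before bQ.
          last : ∀ j → j ≡ i → Around a (c * Q + i) ⊎ c * Q + i ∈ map (_* Q) (boundary elim a)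
          last zero refl = around-or (ℕ.+-identityʳ (c * Q)) (region-pred elim a (path {x = c}) (subst (Region elim a) b≡1+c rb))
          last (suc j) refl = inj₁ (b , rb , ℕ.≤-<-trans (ℕ.+-monoʳ-≤ (c * Q) (ℕ.m≤m+n i k)) lt₁ ,
            subst (λ z → z * Q < c * Q + i + Q) (sym b≡1+c) (subst (_< c * Q + i + Q) (sym (sucQ c)) (ℕ.+-monoˡ-< Q (ℕ.m<m+n (c * Q) (s≤s z≤n)))))
        pred-at a (inj₁ _) (scale {y = y} e) around = around-or refl (region-pred elim a e (around-scaled {a} {y} around))
        pred-at a (inj₂ s) (path {x = x}) (zero , e , 0<o , _) = ⊥-elim (ℕ.<-irrefl refl 0<o)
        pred-at a (inj₂ s) (path {x = x}) (suc o , e , r) = inside-or a (ℕ.suc-injective (trans e (ℕ.+-suc (a * Q) o))) (path-pred (ladder-closed s) r)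
        pred-at a (inj₂ s) (rung c {i} i<k) (o , e , r@(_ , o<Q , _)) with offset-unique {c} {a} (ℕ.+-monoˡ-< k i<k) o<Q e
        ... | refl , refl = inside-or c refl (rung-pred (ladder-closed s) i<k r)
        pred-at a (inj₂ s) (scale {y = y} _) (o , e , 0<o , o<Q , _) with offset-unique {y} {a} 0<Q o<Q (trans (ℕ.+-identityʳ (y * Q)) e)
        ... | _ , refl = ⊥-elim (ℕ.<-irrefl refl 0<o)

        kind% : ∀ t → Kind (t % Q)
        kind% t = kind (ℕ.m%n<n t Q)

      -- The width stays 4: an inner vertex has at most four boundary vertices, all in its own
      -- ladder, and a scaled vertex keeps the boundary that it had in the coarse graph.
      refine : Elimination (Edge (suc m)) 4
      refine = record
        { rank          = newRank
        ; Region        = λ t → regionAt (t / Q) (kind% t)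
        ; boundary      = λ t → boundaryAt (t / Q) (kind% t)
        ; boundary-size = λ t → size-at (t / Q) (kind% t)
        ; region-self   = λ t → subst (regionAt (t / Q) (kind% t)) (offset t) (self-at (t / Q) (ℕ.m%n<n t Q) (kind% t))
        ; region-rank   = λ t {y} r → subst₂ (λ z s → z ≡ s ⊎ newRank z < newRank t) (offset y) (offset t)
                            (rank-at (t / Q) (ℕ.m%n<n t Q) (kind% t) {y / Q} (ℕ.m%n<n y Q)
                              (subst (regionAt (t / Q) (kind% t)) (sym (offset y)) r))
        ; boundary-rank = λ t → boundary-rank-at (t / Q) (kind% t)
        ; region-succ   = λ t → succ-at (t / Q) (kind% t)
        ; region-pred   = λ t → pred-at (t / Q) (kind% t)
        }

    ladder-elimination : ∀ m → Elimination (Edge m) 4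
    ladder-elimination zero    = Elimination-⊆ short (s≤s z≤n) (bandwidth-elimination 1)
      where
      short : ∀ {x y} → Edge 0 x y → x ≤ y × y ≤ x + 1
      short (path {x = x}) = ℕ.n≤1+n x , ℕ.≤-reflexive (ℕ.+-comm 1 x)
    ladder-elimination (suc m) = refine (ladder-elimination m)

  -- Chords of bounded length

  ∑-mono : ∀ n {f g} → (∀ x → x < n → f x ≤ g x) → ∑ n f ≤ ∑ n g
  ∑-mono zero    f≤g = z≤n
  ∑-mono (suc n) f≤g = ℕ.+-mono-≤ (f≤g 0 (s≤s z≤n)) (∑-mono n (λ x x<n → f≤g (suc x) (s≤s x<n)))

  ∑-const : ∀ n c → ∑ n (λ _ → c) ≡ n * c
  ∑-const zero    c = refl
  ∑-const (suc n) c = cong (c +_) (∑-const n c)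

  ∑-split : ∀ m n f → ∑ (m + n) f ≡ ∑ m f + ∑ n (λ x → f (m + x))
  ∑-split zero    n f = refl
  ∑-split (suc m) n f = trans (cong (f 0 +_) (∑-split m n (f ∘ suc))) (sym (ℕ.+-assoc (f 0) (∑ m (f ∘ suc)) _))

  ∑-extend : ∀ {m n} f → m ≤ n → ∑ m f ≤ ∑ n f
  ∑-extend {m} {n} f m≤n = subst (λ n → ∑ m f ≤ ∑ n f) (ℕ.m+[n∸m]≡n m≤n)
    (ℕ.≤-trans (ℕ.m≤m+n (∑ m f) _) (ℕ.≤-reflexive (sym (∑-split m (n ∸ m) f))))

  ∑-window : ∀ {m n o} f → m + o ≤ n → ∑ o (λ i → f (m + i)) ≤ ∑ n f
  ∑-window {m} {n} {o} f le = ℕ.≤-trans (ℕ.m≤n+m _ (∑ m f))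
    (ℕ.≤-trans (ℕ.≤-reflexive (sym (∑-split m o f))) (∑-extend f le))

  ∣-∣≤ : ∀ {a b c} → a ≤ b + c → b ≤ a + c → ∣ a - b ∣ ≤ c
  ∣-∣≤ {a} {b} {c} a≤b+c b≤a+c with ℕ.≤-total a b
  ... | inj₁ a≤b = ℕ.≤-trans (ℕ.≤-reflexive (ℕ.m≤n⇒∣m-n∣≡n∸m a≤b)) (ℕ.m≤n+o⇒m∸n≤o b a b≤a+c)
  ... | inj₂ b≤a = ℕ.≤-trans (ℕ.≤-reflexive (ℕ.m≤n⇒∣n-m∣≡n∸m b≤a)) (ℕ.m≤n+o⇒m∸n≤o a b a≤b+c)

  ⊓-lipschitz : ∀ {a b} c q → a ≤ b + c → a ⊓ q ≤ b ⊓ q + c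
  ⊓-lipschitz {a} {b} c q le with ℕ.⊓-sel b q
  ... | inj₁ e = ℕ.≤-trans (ℕ.m⊓n≤m a q) (subst (λ z → a ≤ z + c) (sym e) le)
  ... | inj₂ e = ℕ.≤-trans (ℕ.m⊓n≤n a q) (subst (λ z → q ≤ z + c) (sym e) (ℕ.m≤m+n q c))

  ≤ᵇ-true : ∀ {x y} → x ≤ y → (x ≤ᵇ y) ≡ true
  ≤ᵇ-true {zero}  _ = refl
  ≤ᵇ-true {suc x} le = <ᵇ-true le

  true-≤ᵇ : ∀ {x y} → (x ≤ᵇ y) ≡ true → x ≤ y
  true-≤ᵇ {zero}  _ = z≤n
  true-≤ᵇ {suc x} e = true-<ᵇ e

  ∧-true : ∀ {a b} → a ∧ b ≡ true → a ≡ true × b ≡ true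
  ∧-true {true} {true} _ = refl , refl

  if-positive : ∀ b {q} → 0 < (if b then q else 0) → b ≡ true
  if-positive true _ = refl

  module Bandwidth (q h : ℕ) (0<q : 0 < q) (q<h : q < h) where

    Cᵇ : ℕ → ℕ → Bool
    Cᵇ x y = (x + h ≤ᵇ y) ∧ (y <ᵇ x + (h + h))

    C : ℕ → ℕ → ℕ
    C x y = if Cᵇ x y then q else 0

    chord-range : ∀ {x y} → 0 < C x y → x + h ≤ y × y < x + (h + h)
    chord-range {x} {y} pos with ∧-true {x + h ≤ᵇ y} (if-positive (Cᵇ x y) pos)
    ... | e₁ , e₂ = true-≤ᵇ e₁ , true-<ᵇ e₂

    chord-weight : ∀ {x y} → x + h ≤ y → y < x + (h + h) → C x y ≡ q
    chord-weight le lt rewrite ≤ᵇ-true le | <ᵇ-true lt = refl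

    chord-weight′ : ∀ {x y} → 0 < C x y → C x y ≡ q
    chord-weight′ {x} {y} pos = chord-weight (proj₁ (chord-range {x} {y} pos)) (proj₂ (chord-range {x} {y} pos))

    chord-long : ∀ {x y} → 0 < C x y → suc x < y
    chord-long {x} {y} pos = ℕ.≤-trans
      (ℕ.≤-trans (ℕ.≤-reflexive (ℕ.+-comm 2 x)) (ℕ.+-monoʳ-≤ x (ℕ.≤-trans (s≤s 0<q) q<h)))
      (proj₁ (chord-range pos))

    open ChordedPath C chord-long public

    -- The potential is the path distance from `x₀` capped at q, but q + 1 at `y₀`. As q < h, the
    -- cap is already reached at the path neighbours of `y₀`. Another chord at `y₀` does not end at
    -- `x₀`, so its other end has value at least 1, and the difference is at most q.
    necessary : ∀ x₀ y₀ → 0 < C x₀ y₀ → Necessary q x₀ y₀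
    necessary x₀ y₀ pos = φ , lipschitz-path , lipschitz-chord , gap
      where
      x₀+h≤y₀ = proj₁ (chord-range pos)

      φ : ℕ → ℕ
      φ z = if z ≡ᵇ y₀ then suc q else ∣ z - x₀ ∣ ⊓ q

      φ-y₀ : φ y₀ ≡ suc q
      φ-y₀ rewrite ≡ᵇ-true {y₀} refl = refl

      φ-other : ∀ {z} → z ≢ y₀ → φ z ≡ ∣ z - x₀ ∣ ⊓ q
      φ-other ne rewrite ≡ᵇ-false ne = refl

      x₀≤y₀ : x₀ ≤ y₀
      x₀≤y₀ = ℕ.≤-trans (ℕ.m≤m+n x₀ h) x₀+h≤y₀

      φ-far : ∀ {z} → z ≢ y₀ → x₀ + q ≤ z → φ z ≡ q
      φ-far {z} ne le = trans (φ-other ne) (ℕ.m≥n⇒m⊓n≡n (ℕ.≤-trans (ℕ.m+n≤o⇒m≤o∸n q (subst (_≤ z) (ℕ.+-comm x₀ q) le))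
        (ℕ.≤-reflexive (sym (ℕ.m≤n⇒∣n-m∣≡n∸m (ℕ.≤-trans (ℕ.m≤m+n x₀ q) le))))))

      adjacent : ∀ z → ∣ z - x₀ ∣ ≤ ∣ suc z - x₀ ∣ + 1 × ∣ suc z - x₀ ∣ ≤ ∣ z - x₀ ∣ + 1
      adjacent z = ℕ.≤-trans (ℕ.∣-∣-triangle z (suc z) x₀) (ℕ.≤-trans (ℕ.≤-reflexive (ℕ.+-comm ∣ z - suc z ∣ _)) (ℕ.+-monoʳ-≤ ∣ suc z - x₀ ∣ (ℕ.≤-reflexive one)))
                 , ℕ.≤-trans (ℕ.∣-∣-triangle (suc z) z x₀) (ℕ.≤-trans (ℕ.≤-reflexive (ℕ.+-comm ∣ suc z - z ∣ _)) (ℕ.+-monoʳ-≤ ∣ z - x₀ ∣ (ℕ.≤-reflexive (trans (ℕ.∣-∣-comm (suc z) z) one))))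
        where
        one : ∣ z - suc z ∣ ≡ 1
        one = trans (cong (∣ z -_∣) (ℕ.+-comm 1 z)) (ℕ.∣m-m+n∣≡n z 1)

      lipschitz-path : ∀ z → ∣ φ z - φ (suc z) ∣ ≤ 1
      lipschitz-path z with z ℕ.≟ y₀ | suc z ℕ.≟ y₀
      ... | yes refl | yes e = ⊥-elim (ℕ.1+n≢n e)
      ... | yes refl | no sz≢ rewrite φ-y₀ | φ-far sz≢ (ℕ.≤-trans (ℕ.+-monoʳ-≤ x₀ (ℕ.<⇒≤ q<h)) (ℕ.≤-trans x₀+h≤y₀ (ℕ.n≤1+n z))) =
              ∣-∣≤ (ℕ.≤-reflexive (ℕ.+-comm 1 q)) (ℕ.≤-trans (ℕ.n≤1+n q) (ℕ.m≤m+n (suc q) 1))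
      ... | no z≢ | yes refl rewrite φ-y₀ | φ-far z≢ (ℕ.≤-pred (ℕ.≤-trans (ℕ.≤-reflexive (sym (ℕ.+-suc x₀ q))) (ℕ.≤-trans (ℕ.+-monoʳ-≤ x₀ q<h) x₀+h≤y₀))) =
              ∣-∣≤ (ℕ.≤-trans (ℕ.n≤1+n q) (ℕ.m≤m+n (suc q) 1)) (ℕ.≤-reflexive (ℕ.+-comm 1 q))
      ... | no z≢ | no sz≢ rewrite φ-other z≢ | φ-other sz≢ =
              ∣-∣≤ (⊓-lipschitz 1 q (proj₁ (adjacent z))) (⊓-lipschitz 1 q (proj₂ (adjacent z)))

      φ-≤q : ∀ {z} → z ≢ y₀ → φ z ≤ q
      φ-≤q {z} ne = ℕ.≤-trans (ℕ.≤-reflexive (φ-other ne)) (ℕ.m⊓n≤n ∣ z - x₀ ∣ q)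

      φ-≥1 : ∀ {z} → z ≢ y₀ → z ≢ x₀ → 1 ≤ φ z
      φ-≥1 {z} ne ne₀ = ℕ.≤-trans (ℕ.⊓-glb (ℕ.n≢0⇒n>0 (ne₀ ∘ ℕ.∣m-n∣≡0⇒m≡n)) 0<q) (ℕ.≤-reflexive (sym (φ-other ne)))

      lipschitz-chord : ∀ x y → 0 < C x y → ¬ (x ≡ x₀ × y ≡ y₀) → ∣ φ x - φ y ∣ ≤ C x y
      lipschitz-chord x y pos′ other = subst (∣ φ x - φ y ∣ ≤_) (sym (chord-weight′ {x} {y} pos′)) (bounded x y pos′ other)
        where
        bounded : ∀ x y → 0 < C x y → ¬ (x ≡ x₀ × y ≡ y₀) → ∣ φ x - φ y ∣ ≤ q
        bounded x y pos′ other with x ℕ.≟ y₀ | y ℕ.≟ y₀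
        ... | yes refl | yes refl = ⊥-elim (ℕ.<⇒≱ (chord-long pos′) (ℕ.n≤1+n x))
        ... | yes refl | no y≢ rewrite φ-y₀ =
                ∣-∣≤ (ℕ.+-monoˡ-≤ q (φ-≥1 y≢ (λ e → ℕ.<⇒≢ (ℕ.≤-<-trans x₀≤y₀ (ℕ.<-trans (ℕ.n<1+n x) (chord-long pos′))) (sym e))))
                     (ℕ.≤-trans (φ-≤q y≢) (ℕ.m≤n+m q (suc q)))
        ... | no x≢ | yes refl rewrite φ-y₀ =
                ∣-∣≤ (ℕ.≤-trans (φ-≤q x≢) (ℕ.m≤n+m q (suc q)))
                     (ℕ.+-monoˡ-≤ q (φ-≥1 x≢ (λ e → other (e , refl))))
        ... | no x≢ | no y≢ = ∣-∣≤ (ℕ.≤-trans (φ-≤q x≢) (ℕ.m≤n+m q (φ y))) (ℕ.≤-trans (φ-≤q y≢) (ℕ.m≤n+m q (φ x)))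

      gap : q * φ x₀ + suc q * C x₀ y₀ ≤ q * φ y₀
      gap rewrite chord-weight′ {x₀} {y₀} pos | φ-y₀ | φ-other {x₀} (λ e → ℕ.<⇒≢ (ℕ.<-trans (ℕ.n<1+n x₀) (chord-long pos)) e)
                | ℕ.∣n-n∣≡0 x₀ | ℕ.*-zeroʳ q = ℕ.≤-reflexive (ℕ.*-comm (suc q) q)

    -- Chords from x end before x + 2h, so each of the first p among p + 2h vertices has all of its
    -- h chords.
    chord-sum : ∀ p → p * (h * q) ≤ ∑ (p + (h + h)) (λ x → ∑ (p + (h + h)) (C x))
    chord-sum p = begin
      p * (h * q)                                  ≡⟨ ∑-const p (h * q) ⟨
      ∑ p (λ _ → h * q)                            ≤⟨ ∑-mono p row ⟩
      ∑ p (λ x → ∑ n (C x))                        ≤⟨ ∑-extend (λ x → ∑ n (C x)) (ℕ.m≤m+n p (h + h)) ⟩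
      ∑ n (λ x → ∑ n (C x))                        ∎
      where
      open ℕ.≤-Reasoning
      n : ℕ
      n = p + (h + h)
      row : ∀ x → x < p → h * q ≤ ∑ n (C x)
      row x x<p = begin
        h * q                                      ≡⟨ ∑-const h q ⟨
        ∑ h (λ _ → q)                              ≤⟨ ∑-mono h (λ i i<h → ℕ.≤-reflexive (sym (chord-weight (ℕ.m≤m+n (x + h) i)
                                                        (subst (x + h + i <_) (ℕ.+-assoc x h h) (ℕ.+-monoʳ-< (x + h) i<h))))) ⟩
        ∑ h (λ i → C x (x + h + i))                ≤⟨ ∑-window {x + h} {n} {h} (C x) (ℕ.≤-trans (ℕ.≤-reflexive (ℕ.+-assoc x h h)) (ℕ.+-monoˡ-≤ (h + h) (ℕ.<⇒≤ x<p))) ⟩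
        ∑ n (C x)                                  ∎

    -- From n ≥ r ≥ 3h, at least a third of the vertices have all their chords. The bounds r ≤ 4h, K
    -- ≤ 2q and q < h reduce the coefficient to 10 h q.
    lightness : ∀ {r n} → h * 3 ≤ r → r ≤ h * 4 → r ≤ n →
                (r * suc q + suc q * suc q) * n ≤ 144 * ∑ n (λ x → ∑ n (C x))
    lightness {r} {n} 3h≤r r≤4h r≤n = begin
      (r * suc q + suc q * suc q) * n                         ≤⟨ ℕ.*-mono-≤ (ℕ.+-mono-≤ (ℕ.*-mono-≤ r≤4h K≤2q) (ℕ.*-mono-≤ q<h K≤2q)) n≤3p ⟩
      (h * 4 * (q + q) + h * (q + q)) * (3 * p)               ≡⟨ rearrange h q p ⟩
      -- The constant is raised from 30 to 144 to agree with the ladder case.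
      30 * (p * (h * q))                                      ≤⟨ ℕ.*-mono-≤ {30} {144} (ℕ.m≤m+n 30 114) (chord-sum p) ⟩
      144 * ∑ (p + (h + h)) (λ x → ∑ (p + (h + h)) (C x))     ≡⟨ cong (λ n → 144 * ∑ n (λ x → ∑ n (C x))) p+2h≡n ⟩
      144 * ∑ n (λ x → ∑ n (C x))                             ∎
      where
      open ℕ.≤-Reasoning
      p : ℕ
      p = n ∸ (h + h)
      3h≤n : h + (h + h) ≤ n
      3h≤n = ℕ.≤-trans (ℕ.≤-reflexive (thrice h)) (ℕ.≤-trans 3h≤r r≤n)
        where
        thrice : ∀ h → h + (h + h) ≡ h * 3
        thrice = solve-∀
      p+2h≡n : p + (h + h) ≡ n
      p+2h≡n = ℕ.m∸n+n≡m (ℕ.≤-trans (ℕ.m≤n+m (h + h) h) 3h≤n)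
      h≤p : h ≤ p
      h≤p = ℕ.m+n≤o⇒m≤o∸n h 3h≤n
      n≤3p : n ≤ 3 * p
      n≤3p = ℕ.≤-trans (ℕ.≤-reflexive (sym p+2h≡n)) (ℕ.≤-trans (ℕ.+-monoʳ-≤ p (ℕ.+-mono-≤ h≤p h≤p)) (ℕ.≤-reflexive (thrice p)))
        where
        thrice : ∀ p → p + (p + p) ≡ 3 * p
        thrice = solve-∀
      K≤2q : suc q ≤ q + q
      K≤2q = ℕ.+-monoˡ-≤ q 0<q
      rearrange : ∀ h q p → (h * 4 * (q + q) + h * (q + q)) * (3 * p) ≡ 30 * (p * (h * q))
      rearrange = solve-∀

  -- The recursive ladder

  ∑-positive : ∀ n f → 0 < ∑ n f → ∃ λ x → x < n × 0 < f x
  ∑-positive (suc n) f pos with f 0 in e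
  ... | suc _ = 0 , s≤s z≤n , subst (0 <_) (sym e) (s≤s z≤n)
  ... | zero with ∑-positive n (f ∘ suc) pos
  ...   | x , x<n , pos′ = suc x , s≤s x<n , pos′

  ∑-zero : ∀ n {f} → (∀ x → f x ≡ 0) → ∑ n f ≡ 0
  ∑-zero n z = trans (∑-cong n z) (trans (∑-const n 0) (ℕ.*-zeroʳ n))

  ∑-single : ∀ n {f} x → x < n → (∀ y → y ≢ x → f y ≡ 0) → ∑ n f ≡ f x
  ∑-single (suc n) {f} zero    _ z = trans (cong (f 0 +_) (∑-zero n (λ y → z (suc y) (λ ())))) (ℕ.+-identityʳ (f 0))
  ∑-single (suc n) (suc x) (s≤s x<n) z = cong₂ _+_ (z 0 (λ ())) (∑-single n x x<n (λ y y≢x → z (suc y) (y≢x ∘ ℕ.suc-injective)))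

  ∑-term : ∀ n f {x} → x < n → f x ≤ ∑ n f
  ∑-term (suc n) f {zero}  _         = ℕ.m≤m+n (f 0) (∑ n (f ∘ suc))
  ∑-term (suc n) f {suc x} (s≤s x<n) = ℕ.≤-trans (∑-term n (f ∘ suc) x<n) (ℕ.m≤n+m (∑ n (f ∘ suc)) (f 0))

  ∑-+ : ∀ n f g → ∑ n (λ x → f x + g x) ≡ ∑ n f + ∑ n g
  ∑-+ zero    f g = refl
  ∑-+ (suc n) f g = trans (cong (f 0 + g 0 +_) (∑-+ n (f ∘ suc) (g ∘ suc))) (interchange (f 0) (g 0) _ _)
    where
    interchange : ∀ a b c d → a + b + (c + d) ≡ a + c + (b + d)
    interchange = solve-∀

  ∑-swap : ∀ m n (f : ℕ → ℕ → ℕ) → ∑ m (λ x → ∑ n (f x)) ≡ ∑ n (λ y → ∑ m (λ x → f x y))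
  ∑-swap zero    n f = sym (∑-zero n (λ _ → refl))
  ∑-swap (suc m) n f = trans (cong (∑ n (f 0) +_) (∑-swap m n (f ∘ suc))) (sym (∑-+ n (f 0) _))

  ∑-sample : ∀ B P .{{_ : NonZero P}} f → ∑ B (λ b → f (b * P)) ≤ ∑ (B * P) f
  ∑-sample zero    P f = z≤n
  ∑-sample (suc B) P f = ℕ.≤-trans
    (ℕ.+-mono-≤ (∑-term P f (ℕ.>-nonZero⁻¹ P)) (∑-sample B P (f ∘ (P +_))))
    (ℕ.≤-reflexive (sym (∑-split P (B * P) f)))

  ∑-* : ∀ n c f → c * ∑ n f ≡ ∑ n (λ x → c * f x)
  ∑-* zero    c f = ℕ.*-zeroʳ c
  ∑-* (suc n) c f = trans (ℕ.*-distribˡ-+ c (f 0) (∑ n (f ∘ suc))) (cong (c * f 0 +_) (∑-* n c (f ∘ suc)))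

  ∑-blocks : ∀ B P f → ∑ (B * P) f ≡ ∑ B (λ b → ∑ P (λ i → f (b * P + i)))
  ∑-blocks zero    P f = refl
  ∑-blocks (suc B) P f = trans (∑-split P (B * P) f) (cong (∑ P f +_)
    (trans (∑-blocks B P (f ∘ (P +_))) (∑-cong B (λ b → ∑-cong P (λ i → cong f (sym (ℕ.+-assoc P (b * P) i)))))))

  -- Shortening a line by one level of chords

  module Squash (K E : ℕ) .{{_ : NonZero K}} (E<K : E < K) where

    -- The piecewise linear map that rises with slope 1 on [0, E], is constant on [E, K],
    -- and continues with h ↦ h + K, squash h ↦ squash h + E.
    squash : ℕ → ℕ
    squash h = (h / K) * E + (h % K) ⊓ E

    squash-period : ∀ h → squash (h + K) ≡ squash h + E
    squash-period h = begin
      (h + K) / K * E + ((h + K) % K) ⊓ E   ≡⟨ cong₂ (λ a b → a * E + b ⊓ E) quotient (ℕ.[m+n]%n≡m%n h K) ⟩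
      (h / K + 1) * E + (h % K) ⊓ E         ≡⟨ rearrange (h / K) E ((h % K) ⊓ E) ⟩
      (h / K) * E + (h % K) ⊓ E + E         ∎
      where
      open ≡-Reasoning
      quotient : (h + K) / K ≡ h / K + 1
      quotient = trans (ℕ.+-distrib-/-∣ʳ h ℕ.∣-refl) (cong (h / K +_) (ℕ.n/n≡1 K))
      rearrange : ∀ a e c → (a + 1) * e + c ≡ a * e + c + e
      rearrange = solve-∀

    squash-offset : ∀ a {i} → i < K → squash (a * K + i) ≡ a * E + i ⊓ E
    squash-offset zero    i<K = cong₂ (λ a b → a * E + b ⊓ E) (ℕ.m<n⇒m/n≡0 i<K) (ℕ.m<n⇒m%n≡m i<K)
    squash-offset (suc a) {i} i<K = begin
      squash (K + a * K + i)     ≡⟨ cong squash (trans (ℕ.+-assoc K (a * K) i) (ℕ.+-comm K (a * K + i))) ⟩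
      squash (a * K + i + K)     ≡⟨ squash-period (a * K + i) ⟩
      squash (a * K + i) + E     ≡⟨ cong (_+ E) (squash-offset a i<K) ⟩
      a * E + i ⊓ E + E          ≡⟨ trans (ℕ.+-comm (a * E + i ⊓ E) E) (sym (ℕ.+-assoc E (a * E) (i ⊓ E))) ⟩
      suc a * E + i ⊓ E          ∎
      where open ≡-Reasoning

    squash-suc : ∀ h → squash h ≤ squash (suc h) × squash (suc h) ≤ squash h + 1
    squash-suc h = subst (λ h → squash h ≤ squash (suc h) × squash (suc h) ≤ squash h + 1)
      (trans (ℕ.+-comm (h / K * K) (h % K)) (sym (ℕ.m≡m%n+[m/n]*n h K))) (step (h / K) (h % K) (ℕ.m≤n⇒m<n∨m≡n (ℕ.m%n<n h K)))
      where
      step : ∀ a i → suc i < K ⊎ suc i ≡ K → squash (a * K + i) ≤ squash (suc (a * K + i)) × squash (suc (a * K + i)) ≤ squash (a * K + i) + 1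
      step a i (inj₁ si<K) rewrite sym (ℕ.+-suc (a * K) i) | squash-offset a si<K | squash-offset a (ℕ.<⇒≤ si<K) =
        ℕ.+-monoʳ-≤ (a * E) (ℕ.⊓-monoˡ-≤ E (ℕ.n≤1+n i)) ,
        ℕ.≤-trans (ℕ.+-monoʳ-≤ (a * E) (⊓-lipschitz 1 E (ℕ.≤-reflexive (ℕ.+-comm 1 i)))) (ℕ.≤-reflexive (sym (ℕ.+-assoc (a * E) (i ⊓ E) 1)))
      -- The last step of a period is flat: E < K gives E ≤ K - 1 = i.
      step a i (inj₂ si≡K) = ℕ.≤-reflexive (sym same) , ℕ.≤-trans (ℕ.≤-reflexive same) (ℕ.m≤m+n _ 1)
        where
        0<K : 0 < K
        0<K = ℕ.≤-<-trans z≤n E<K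
        same : squash (suc (a * K + i)) ≡ squash (a * K + i)
        same = begin
          squash (suc (a * K + i))   ≡⟨ cong squash (trans (sym (ℕ.+-suc (a * K) i)) (trans (cong (a * K +_) si≡K)
                                          (trans (ℕ.+-comm (a * K) K) (sym (ℕ.+-identityʳ (suc a * K)))))) ⟩
          squash (suc a * K + 0)     ≡⟨ squash-offset (suc a) 0<K ⟩
          E + a * E + 0              ≡⟨ trans (ℕ.+-identityʳ (E + a * E)) (ℕ.+-comm E (a * E)) ⟩
          a * E + E                  ≡⟨ cong (a * E +_) (ℕ.m≥n⇒m⊓n≡n (ℕ.≤-pred (subst (E <_) (sym si≡K) E<K))) ⟨
          a * E + i ⊓ E              ≡⟨ squash-offset a (subst (i <_) si≡K (ℕ.n<1+n i)) ⟨
          squash (a * K + i)         ∎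
          where open ≡-Reasoning

    squash-+ : ∀ h d → squash h ≤ squash (h + d) × squash (h + d) ≤ squash h + d
    squash-+ h zero rewrite ℕ.+-identityʳ h | ℕ.+-identityʳ (squash h) = ℕ.≤-refl , ℕ.≤-refl
    squash-+ h (suc d) rewrite ℕ.+-suc h d =
      ℕ.≤-trans (proj₁ (squash-+ h d)) (proj₁ (squash-suc (h + d))) ,
      ℕ.≤-trans (proj₂ (squash-suc (h + d))) (ℕ.≤-trans (ℕ.+-monoˡ-≤ 1 (proj₂ (squash-+ h d)))
        (ℕ.≤-reflexive (trans (ℕ.+-assoc (squash h) d 1) (cong (squash h +_) (ℕ.+-comm d 1)))))

    squash-mono : ∀ {h h′} → h ≤ h′ → squash h ≤ squash h′
    squash-mono {h} {h′} le = subst (λ z → squash h ≤ squash z) (ℕ.m+[n∸m]≡n le) (proj₁ (squash-+ h (h′ ∸ h)))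

    squash-lipschitz : ∀ {h h′} d → h′ ≤ h + d → squash h′ ≤ squash h + d
    squash-lipschitz {h} d le = ℕ.≤-trans (squash-mono le) (proj₂ (squash-+ h d))

  -- Chords, potentials and total weight of the recursive ladder

  module Recursive (q-1 m : ℕ) where
    q : ℕ
    q = suc q-1
    open Ladder q

    -- The distance between the ends of a copy of depth l, which two rungs of its top level cross;
    -- along the path it is `Q ^ l`.
    D : ℕ → ℕ
    D l = (q + q) ^ l

    kD-nonZero : ∀ {l} → NonZero (k * D l)
    kD-nonZero {l} = ℕ.m*n≢0 k (D l) {{_}} {{ℕ.m^n≢0 (q + q) l}}

    0<D : ∀ l → 0 < D l
    0<D l = ℕ.m^n>0 (q + q) l

    qD<kD : ∀ l → q * D l < k * D l
    qD<kD l = ℕ.m<n+m (q * D l) (0<D l)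

    -- A chord of level l replaces k consecutive copies of depth l, a distance of `k * D l`, by its
    -- weight `q * D l`. These are the period of the map and its rise per period.
    module S (l : ℕ) = Squash (k * D l) (q * D l) {{kD-nonZero {l}}} (qD<kD l)

    -- A lower bound for the position along the path after shortening by the chords of the
    -- levels below l.
    height : ℕ → ℕ → ℕ
    height zero    x = x
    height (suc l) x = S.squash l (height l x)

    height-mono : ∀ l {x y} → x ≤ y → height l x ≤ height l y
    height-mono zero    le = le
    height-mono (suc l) le = S.squash-mono l (height-mono l le)

    height-suc : ∀ l x → height l (suc x) ≤ height l x + 1
    height-suc zero    x = ℕ.≤-reflexive (ℕ.+-comm 1 x)
    height-suc (suc l) x = S.squash-lipschitz l 1 (height-suc l x)

    height-periods : ∀ l → (∀ x → height l (x + Q ^ l) ≡ height l x + D l) →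
                     ∀ c x → height l (x + c * Q ^ l) ≡ height l x + c * D l
    height-periods l period zero    x = trans (cong (height l) (ℕ.+-identityʳ x)) (sym (ℕ.+-identityʳ (height l x)))
    height-periods l period (suc c) x = begin
      height l (x + (Q ^ l + c * Q ^ l))   ≡⟨ cong (height l) (sym (ℕ.+-assoc x (Q ^ l) (c * Q ^ l))) ⟩
      height l (x + Q ^ l + c * Q ^ l)     ≡⟨ height-periods l period c (x + Q ^ l) ⟩
      height l (x + Q ^ l) + c * D l       ≡⟨ cong (_+ c * D l) (period x) ⟩
      height l x + D l + c * D l           ≡⟨ ℕ.+-assoc (height l x) (D l) (c * D l) ⟩
      height l x + suc c * D l             ∎
      where open ≡-Reasoning

    -- By induction k copies of depth l raise `height l` by one full period of the next squash map,
    -- hence `height (suc l)` by `q * D l`. Two such halves form a copy of depth l + 1.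
    height-period : ∀ l x → height l (x + Q ^ l) ≡ height l x + D l
    height-rung : ∀ l x → height (suc l) (x + k * Q ^ l) ≡ height (suc l) x + q * D l

    height-period zero    x = refl
    height-period (suc l) x = begin
      height (suc l) (x + Q ^ suc l)                     ≡⟨ cong (λ z → height (suc l) (x + z)) (ℕ.*-distribʳ-+ (Q ^ l) k k) ⟩
      height (suc l) (x + (k * Q ^ l + k * Q ^ l))       ≡⟨ cong (height (suc l)) (sym (ℕ.+-assoc x (k * Q ^ l) (k * Q ^ l))) ⟩
      height (suc l) (x + k * Q ^ l + k * Q ^ l)         ≡⟨ height-rung l (x + k * Q ^ l) ⟩
      height (suc l) (x + k * Q ^ l) + q * D l           ≡⟨ cong (_+ q * D l) (height-rung l x) ⟩
      height (suc l) x + q * D l + q * D l               ≡⟨ ℕ.+-assoc (height (suc l) x) (q * D l) (q * D l) ⟩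
      height (suc l) x + (q * D l + q * D l)             ≡⟨ cong (height (suc l) x +_) (ℕ.*-distribʳ-+ (D l) q q) ⟨
      height (suc l) x + D (suc l)                       ∎
      where open ≡-Reasoning

    height-rung l x = trans (cong (S.squash l) (height-periods l (height-period l) k x)) (S.squash-period l (height l x))

    -- The bound holds with equality for `height (suc t)`, and the later squash maps, being monotone
    -- and 1-Lipschitz, preserve it.
    height-chord : ∀ {t l} → t < l → ∀ x → height l (x + k * Q ^ t) ≤ height l x + q * D t
    height-chord {t} {suc l} (s≤s t≤l) x with ℕ.m≤n⇒m<n∨m≡n t≤l
    ... | inj₁ t<l  = S.squash-lipschitz l (q * D t) (height-chord t<l x)
    ... | inj₂ refl = ℕ.≤-reflexive (height-rung l x)

    -- The chords of level l start at (b Q + j) Q^l with j < k: these are ends of copies of depth l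
    -- in the first half of a copy of depth l + 1.
    start : ℕ → ℕ → Bool
    start zero    x = x % Q <ᵇ k
    start (suc l) x = (x % Q ≡ᵇ 0) ∧ start l (x / Q)

    Cᵇ : ℕ → ℕ → ℕ → Bool
    Cᵇ l x y = start l x ∧ (y ≡ᵇ x + k * Q ^ l)

    levelWeight : ℕ → ℕ → ℕ → ℕ
    levelWeight l x y = if Cᵇ l x y then q * D l else 0

    -- At most one level contributes, because the length k Q^l of a chord determines l.
    C : ℕ → ℕ → ℕ
    C x y = ∑ m (λ l → levelWeight l x y)

    scaled : ∀ x → (x % Q ≡ᵇ 0) ≡ true → x / Q * Q ≡ x
    scaled x e = trans (sym (ℕ.+-identityʳ (x / Q * Q))) (trans (cong (x / Q * Q +_) (sym (true-≡ᵇ {x % Q} e))) (offset x))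

    start-edge : ∀ {l M} → l < M → ∀ x → start l x ≡ true → Edge M x (x + k * Q ^ l)
    start-edge {zero} {suc M} _ x s = subst₂ (Edge (suc M)) (offset x)
      (trans (sym (ℕ.+-assoc (x / Q * Q) (x % Q) k)) (cong₂ _+_ (offset x) (sym (ℕ.*-identityʳ k))))
      (rung (x / Q) (true-<ᵇ s))
    start-edge {suc l} {suc M} (s≤s l<M) x s with ∧-true {x % Q ≡ᵇ 0} s
    ... | s₁ , s₂ = subst₂ (Edge (suc M)) (scaled x s₁)
      (trans (ℕ.*-distribʳ-+ Q (x / Q) (k * Q ^ l)) (cong₂ _+_ (scaled x s₁) (rearrange k (Q ^ l) Q)))
      (scale (start-edge l<M (x / Q) s₂))
      where
      rearrange : ∀ k p Q → k * p * Q ≡ k * (Q * p)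
      rearrange = solve-∀

    start-multiple : ∀ l x → start l x ≡ true → ∃ λ z → x ≡ z * Q ^ l
    start-multiple zero    x s = x , sym (ℕ.*-identityʳ x)
    start-multiple (suc l) x s with ∧-true {x % Q ≡ᵇ 0} s
    ... | s₁ , s₂ with start-multiple l (x / Q) s₂
    ...   | z , e = z , trans (sym (scaled x s₁)) (trans (cong (_* Q) e) (rearrange z (Q ^ l) Q))
      where
      rearrange : ∀ z p Q → z * p * Q ≡ z * (Q * p)
      rearrange = solve-∀

    start-complete : ∀ l b {j} → j < k → start l ((b * Q + j) * Q ^ l) ≡ true
    start-complete zero b {j} j<k = trans (cong (λ x → x % Q <ᵇ k) (ℕ.*-identityʳ (b * Q + j)))
      (trans (cong (_<ᵇ k) (offset-% b (ℕ.<-trans j<k k<Q))) (<ᵇ-true j<k))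
    start-complete (suc l) b {j} j<k = trans (cong (start (suc l)) (rearrange (b * Q + j) Q (Q ^ l)))
      (cong₂ _∧_ (≡ᵇ-true (ℕ.m*n%n≡0 ((b * Q + j) * Q ^ l) Q))
                 (trans (cong (start l) (ℕ.m*n/n≡m ((b * Q + j) * Q ^ l) Q)) (start-complete l b j<k)))
      where
      rearrange : ∀ z Q p → z * (Q * p) ≡ z * p * Q
      rearrange = solve-∀

    chord-level : ∀ {x y} → 0 < C x y → ∃ λ l → l < m × start l x ≡ true × y ≡ x + k * Q ^ l
    chord-level {x} {y} pos with ∑-positive m (λ l → levelWeight l x y) pos
    ... | l , l<m , pos′ with ∧-true {start l x} (if-positive (Cᵇ l x y) pos′)
    ...   | s , e = l , l<m , s , true-≡ᵇ {y} e

    Q^-injective : ∀ {l l′} → Q ^ l ≡ Q ^ l′ → l ≡ l′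
    Q^-injective {l} {l′} e with ℕ.<-cmp l l′
    ... | tri≈ _ l≡l′ _ = l≡l′
    ... | tri< lt _ _ = ⊥-elim (ℕ.<⇒≢ (ℕ.^-monoʳ-< Q (s≤s (ℕ.≤-trans (s≤s z≤n) (ℕ.m≤n+m k q))) lt) e)
    ... | tri> _ _ gt = ⊥-elim (ℕ.<⇒≢ (ℕ.^-monoʳ-< Q (s≤s (ℕ.≤-trans (s≤s z≤n) (ℕ.m≤n+m k q))) gt) (sym e))

    chord-weight : ∀ {l x} → l < m → start l x ≡ true → C x (x + k * Q ^ l) ≡ q * D l
    chord-weight {l} {x} l<m s = trans (∑-single m l l<m other) (cong (λ b → if b then q * D l else 0) (cong₂ _∧_ s (≡ᵇ-true {x + k * Q ^ l} refl)))
      where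
      other : ∀ l′ → l′ ≢ l → levelWeight l′ x (x + k * Q ^ l) ≡ 0
      other l′ l′≢l = cong (λ b → if b then q * D l′ else 0) (trans (cong (start l′ x ∧_)
        (≡ᵇ-false {x + k * Q ^ l} (λ e → l′≢l (sym (Q^-injective (ℕ.*-cancelˡ-≡ (Q ^ l) (Q ^ l′) k (ℕ.+-cancelˡ-≡ x _ _ e))))))) (Bool.∧-zeroʳ (start l′ x)))

    0<Q^ : ∀ l → 0 < Q ^ l
    0<Q^ l = ℕ.m^n>0 Q l

    chord-long : ∀ {x y} → 0 < C x y → suc x < y
    chord-long {x} {y} pos with chord-level {x} {y} pos
    ... | l , _ , _ , refl = ℕ.≤-trans (ℕ.≤-reflexive (ℕ.+-comm 2 x))
      (ℕ.+-monoʳ-≤ x (ℕ.≤-trans (ℕ.≤-trans (s≤s (s≤s z≤n)) (ℕ.≤-reflexive (sym (ℕ.*-identityʳ k)))) (ℕ.*-monoʳ-≤ k (0<Q^ l))))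

    open ChordedPath C chord-long public

    chord-edge : ∀ {x y} → 0 < C x y → Edge m x y
    chord-edge {x} {y} pos with chord-level {x} {y} pos
    ... | l , l<m , s , refl = start-edge l<m x s

    -- The potential is the height of level l above `x₀`, capped at its value `k * D l` at the upper
    -- end of the chord. Chords of lower levels respect the height itself, those of higher levels
    -- weigh at least as much as the cap, and `same-level` treats the rest.
    necessary : ∀ x₀ y₀ → 0 < C x₀ y₀ → Necessary q x₀ y₀
    necessary x₀ y₀ pos with chord-level {x₀} {y₀} pos
    ... | l , l<m , s₀ , refl = φ , lipschitz-path , lipschitz-chord , gap
      where
      φ : ℕ → ℕ
      φ y = (height l y ∸ height l x₀) ⊓ (k * D l)

      φ-mono : ∀ {x y} → x ≤ y → φ x ≤ φ y
      φ-mono le = ℕ.⊓-monoˡ-≤ (k * D l) (ℕ.∸-monoˡ-≤ (height l x₀) (height-mono l le))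

      φ-lipschitz : ∀ {x y} d → x ≤ y → height l y ≤ height l x + d → ∣ φ x - φ y ∣ ≤ d
      φ-lipschitz {x} {y} d x≤y le = ∣-∣≤ (ℕ.≤-trans (φ-mono x≤y) (ℕ.m≤m+n (φ y) d)) (⊓-lipschitz d (k * D l)
        (ℕ.m≤n+o⇒m∸n≤o (height l y) (height l x₀) (ℕ.≤-trans le (ℕ.≤-trans (ℕ.+-monoˡ-≤ d (ℕ.m≤n+m∸n (height l x) (height l x₀)))
          (ℕ.≤-reflexive (ℕ.+-assoc (height l x₀) (height l x ∸ height l x₀) d))))))

      lipschitz-path : ∀ x → ∣ φ x - φ (suc x) ∣ ≤ 1
      lipschitz-path x = φ-lipschitz 1 (ℕ.n≤1+n x) (height-suc l x)

      φ-≤ : ∀ y → φ y ≤ k * D l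
      φ-≤ y = ℕ.m⊓n≤n _ (k * D l)

      high-level : ∀ {t} → l < t → k * D l ≤ q * D t
      high-level {t} l<t = begin
        k * D l         ≤⟨ ℕ.*-monoˡ-≤ (D l) (s≤s (ℕ.m≤n+m q q-1)) ⟩
        (q + q) * D l   ≤⟨ ℕ.^-monoʳ-≤ (q + q) l<t ⟩
        D t             ≤⟨ ℕ.m≤m+n (D t) (q-1 * D t) ⟩
        q * D t         ∎
        where open ℕ.≤-Reasoning

      -- Chords of level l start at multiples of Q^l, so another one is shifted by at least a whole
      -- copy. At least one of its k copies then lies where φ is constantly zero or at the cap, and
      -- the other q copies account for at most `q * D l`.
      same-level : ∀ x z z₀ → x ≡ z * Q ^ l → x₀ ≡ z₀ * Q ^ l → x ≢ x₀ →
                   ∣ φ x - φ (x + k * Q ^ l) ∣ ≤ q * D l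
      same-level x z z₀ ez ez₀ x≢x₀ with ℕ.<-cmp z z₀
      ... | tri≈ _ refl _ = ⊥-elim (x≢x₀ (trans ez (sym ez₀)))
      ... | tri< z<z₀ _ _ = ∣-∣≤ (ℕ.≤-trans (φ-mono (ℕ.m≤m+n x _)) (ℕ.m≤m+n (φ y) (q * D l))) (ℕ.≤-trans φy≤qD (ℕ.m≤n+m (q * D l) (φ x)))
        where
        y : ℕ
        y = x + k * Q ^ l
        y≤ : x + k * Q ^ l ≤ x₀ + q * Q ^ l
        y≤ = begin
          x + (Q ^ l + q * Q ^ l)        ≡⟨ ℕ.+-assoc x (Q ^ l) (q * Q ^ l) ⟨
          x + Q ^ l + q * Q ^ l          ≡⟨ cong (λ x → x + Q ^ l + q * Q ^ l) ez ⟩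
          z * Q ^ l + Q ^ l + q * Q ^ l  ≡⟨ cong (_+ q * Q ^ l) (ℕ.+-comm (z * Q ^ l) (Q ^ l)) ⟩
          suc z * Q ^ l + q * Q ^ l      ≤⟨ ℕ.+-monoˡ-≤ (q * Q ^ l) (ℕ.*-monoˡ-≤ (Q ^ l) z<z₀) ⟩
          z₀ * Q ^ l + q * Q ^ l         ≡⟨ cong (_+ q * Q ^ l) ez₀ ⟨
          x₀ + q * Q ^ l                 ∎
          where open ℕ.≤-Reasoning
        φy≤qD : φ y ≤ q * D l
        φy≤qD = ℕ.≤-trans (ℕ.m⊓n≤m _ (k * D l)) (ℕ.m≤n+o⇒m∸n≤o (height l y) (height l x₀)
          (ℕ.≤-trans (height-mono l y≤) (ℕ.≤-reflexive (height-periods l (height-period l) q x₀))))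
      ... | tri> _ _ z₀<z = ∣-∣≤ (ℕ.≤-trans (φ-mono (ℕ.m≤m+n x _)) (ℕ.m≤m+n (φ y) (q * D l))) (ℕ.≤-trans (φ-≤ y) (ℕ.+-monoˡ-≤ (q * D l) D≤φx))
        where
        y : ℕ
        y = x + k * Q ^ l
        x₀+Q^l≤x : x₀ + Q ^ l ≤ x
        x₀+Q^l≤x = subst₂ (λ x₀ x → x₀ + Q ^ l ≤ x) (sym ez₀) (sym ez)
          (ℕ.≤-trans (ℕ.≤-reflexive (ℕ.+-comm (z₀ * Q ^ l) (Q ^ l))) (ℕ.*-monoˡ-≤ (Q ^ l) z₀<z))
        D≤φx : D l ≤ φ x
        D≤φx = ℕ.⊓-glb (ℕ.m+n≤o⇒m≤o∸n (D l) (ℕ.≤-trans (ℕ.≤-reflexive (trans (ℕ.+-comm (D l) (height l x₀)) (sym (height-period l x₀)))) (height-mono l x₀+Q^l≤x)))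
                       (ℕ.m≤m+n (D l) (q * D l))

      lipschitz-chord : ∀ x y → 0 < C x y → ¬ (x ≡ x₀ × y ≡ x₀ + k * Q ^ l) → ∣ φ x - φ y ∣ ≤ C x y
      lipschitz-chord x y pos′ other with chord-level {x} {y} pos′
      ... | t , t<m , s , refl = subst (∣ φ x - φ (x + k * Q ^ t) ∣ ≤_) (sym (chord-weight t<m s)) bounded
        where
        bounded : ∣ φ x - φ (x + k * Q ^ t) ∣ ≤ q * D t
        bounded with ℕ.<-cmp t l
        ... | tri< t<l _ _ = φ-lipschitz (q * D t) (ℕ.m≤m+n x _) (height-chord t<l x)
        ... | tri> _ _ l<t = ∣-∣≤ (ℕ.≤-trans (ℕ.≤-trans (φ-≤ x) (high-level l<t)) (ℕ.m≤n+m (q * D t) (φ (x + k * Q ^ t))))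
                                  (ℕ.≤-trans (ℕ.≤-trans (φ-≤ (x + k * Q ^ t)) (high-level l<t)) (ℕ.m≤n+m (q * D t) (φ x)))
        ... | tri≈ _ refl _ = same-level x (proj₁ (start-multiple l x s)) (proj₁ (start-multiple l x₀ s₀))
                                (proj₂ (start-multiple l x s)) (proj₂ (start-multiple l x₀ s₀)) (λ e → other (e , cong (_+ k * Q ^ l) e))

      gap : q * φ x₀ + suc q * C x₀ (x₀ + k * Q ^ l) ≤ q * φ (x₀ + k * Q ^ l)
      gap = ℕ.≤-reflexive (begin
        q * φ x₀ + suc q * C x₀ (x₀ + k * Q ^ l)   ≡⟨ cong₂ (λ a b → q * (a ⊓ (k * D l)) + suc q * b) (ℕ.n∸n≡0 (height l x₀)) (chord-weight l<m s₀) ⟩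
        q * 0 + suc q * (q * D l)                  ≡⟨ rearrange q (D l) ⟩
        q * (k * D l)                              ≡⟨ cong (q *_) φ-end ⟨
        q * φ (x₀ + k * Q ^ l)                     ∎)
        where
        open ≡-Reasoning
        rearrange : ∀ q d → q * 0 + suc q * (q * d) ≡ q * (suc q * d)
        rearrange = solve-∀
        φ-end : φ (x₀ + k * Q ^ l) ≡ k * D l
        φ-end = trans (cong (_⊓ (k * D l)) (trans (cong (_∸ height l x₀) (height-periods l (height-period l) k x₀)) (ℕ.m+n∸m≡n (height l x₀) (k * D l))))
                      (ℕ.⊓-idem (k * D l))

    -- Each copy of depth l + 1 contributes k chords of level l. The strict inequality makes room
    -- for the upper end of the last copy.
    level-sum : ∀ l n B → B * Q ^ suc l < n → B * (k * (q * D l)) ≤ ∑ n (λ x → ∑ n (levelWeight l x))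
    level-sum l n B B<n = begin
      B * (k * w)                                                    ≡⟨ ∑-const B (k * w) ⟨
      ∑ B (λ _ → k * w)                                              ≤⟨ ∑-mono B block ⟩
      ∑ B (λ b → ∑ (Q ^ suc l) (λ i → row (b * Q ^ suc l + i)))      ≡⟨ ∑-blocks B (Q ^ suc l) row ⟨
      ∑ (B * Q ^ suc l) row                                          ≤⟨ ∑-extend row (ℕ.<⇒≤ B<n) ⟩
      ∑ n row                                                        ∎
      where
      open ℕ.≤-Reasoning
      w : ℕ
      w = q * D l
      row : ℕ → ℕ
      row x = ∑ n (levelWeight l x)

      entry : ∀ {b j} → b < B → j < k → w ≤ row (b * Q ^ suc l + j * Q ^ l)
      entry {b} {j} b<B j<k = subst (λ x → w ≤ row x) (rearrange b j Q (Q ^ l))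
        (ℕ.≤-trans (ℕ.≤-reflexive (sym hit)) (∑-term n (levelWeight l x) y<n))
        where
        rearrange : ∀ b j Q p → (b * Q + j) * p ≡ b * (Q * p) + j * p
        rearrange = solve-∀
        x y : ℕ
        x = (b * Q + j) * Q ^ l
        y = x + k * Q ^ l
        hit : levelWeight l x y ≡ w
        hit = cong (λ b → if b then w else 0) (cong₂ _∧_ (start-complete l b j<k) (≡ᵇ-true {y} refl))
        y<n : y < n
        y<n = begin-strict
          (b * Q + j) * Q ^ l + k * Q ^ l  ≡⟨ ℕ.*-distribʳ-+ (Q ^ l) (b * Q + j) k ⟨
          (b * Q + j + k) * Q ^ l          ≤⟨ ℕ.*-monoˡ-≤ (Q ^ l) (ℕ.≤-trans (ℕ.≤-reflexive (ℕ.+-assoc (b * Q) j k)) (ℕ.+-monoʳ-≤ (b * Q) (ℕ.+-monoˡ-≤ k (ℕ.<⇒≤ j<k)))) ⟩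
          (b * Q + Q) * Q ^ l              ≡⟨ cong (_* Q ^ l) (ℕ.+-comm (b * Q) Q) ⟩
          suc b * Q * Q ^ l                ≡⟨ ℕ.*-assoc (suc b) Q (Q ^ l) ⟩
          suc b * Q ^ suc l                ≤⟨ ℕ.*-monoˡ-≤ (Q ^ suc l) b<B ⟩
          B * Q ^ suc l                    <⟨ B<n ⟩
          n                                ∎

      block : ∀ b → b < B → k * w ≤ ∑ (Q ^ suc l) (λ i → row (b * Q ^ suc l + i))
      block b b<B = begin
        k * w                                                 ≡⟨ ∑-const k w ⟨
        ∑ k (λ _ → w)                                         ≤⟨ ∑-mono k (λ j j<k → entry b<B j<k) ⟩
        ∑ k (λ j → row (b * Q ^ suc l + j * Q ^ l))           ≤⟨ ∑-extend (λ j → row (b * Q ^ suc l + j * Q ^ l)) (ℕ.m≤m+n k k) ⟩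
        ∑ Q (λ j → row (b * Q ^ suc l + j * Q ^ l))           ≤⟨ ∑-sample Q (Q ^ l) {{ℕ.m^n≢0 Q l}} (λ i → row (b * Q ^ suc l + i)) ⟩
        ∑ (Q ^ suc l) (λ i → row (b * Q ^ suc l + i))         ∎

    -- Bernoulli's inequality (1 - 1/k)^l ≥ 1 - l/k with denominators cleared, since D l / Q^l =
    -- (q/k)^l.
    bernoulli : ∀ l → l ≤ k → Q ^ l * (k ∸ l) ≤ D l * k
    bernoulli zero    _    = ℕ.≤-refl
    bernoulli (suc l) l<k = begin
      Q * Q ^ l * c                  ≡⟨ rearrange₁ k (Q ^ l) c ⟩
      -- As k = q + 1, the inequality k c ≤ q (c + 1) amounts to c ≤ q.
      2 * Q ^ l * (k * c)            ≤⟨ ℕ.*-monoʳ-≤ (2 * Q ^ l) (ℕ.≤-trans (ℕ.+-monoˡ-≤ (q * c) c≤q) (ℕ.≤-reflexive (sym (ℕ.*-suc q c)))) ⟩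
      2 * Q ^ l * (q * suc c)        ≡⟨ cong (λ z → 2 * Q ^ l * (q * z)) (sym (ℕ.+-∸-assoc 1 l<k)) ⟩
      2 * Q ^ l * (q * (k ∸ l))      ≡⟨ rearrange₂ (Q ^ l) q (k ∸ l) ⟩
      2 * q * (Q ^ l * (k ∸ l))      ≤⟨ ℕ.*-monoʳ-≤ (2 * q) (bernoulli l (ℕ.<⇒≤ l<k)) ⟩
      2 * q * (D l * k)              ≡⟨ rearrange₃ q (D l) k ⟩
      (q + q) * D l * k              ∎
      where
      open ℕ.≤-Reasoning
      c : ℕ
      c = k ∸ suc l
      c≤q : c ≤ q
      c≤q = ℕ.m∸n≤m q l
      rearrange₁ : ∀ k p c → (k + k) * p * c ≡ 2 * p * (k * c)
      rearrange₁ = solve-∀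
      rearrange₂ : ∀ p q c → 2 * p * (q * c) ≡ 2 * q * (p * c)
      rearrange₂ = solve-∀
      rearrange₃ : ∀ q d k → 2 * q * (d * k) ≡ (q + q) * d * k
      rearrange₃ = solve-∀

    Q^≤2D : ∀ l → l + l ≤ k → Q ^ l ≤ 2 * D l
    Q^≤2D l 2l≤k = ℕ.*-cancelʳ-≤ (Q ^ l) (2 * D l) k (begin
      Q ^ l * k                ≤⟨ ℕ.*-monoʳ-≤ (Q ^ l) half ⟩
      Q ^ l * (2 * (k ∸ l))    ≡⟨ rearrange (Q ^ l) (k ∸ l) ⟩
      2 * (Q ^ l * (k ∸ l))    ≤⟨ ℕ.*-monoʳ-≤ 2 (bernoulli l l≤k) ⟩
      2 * (D l * k)            ≡⟨ ℕ.*-assoc 2 (D l) k ⟨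
      2 * D l * k              ∎)
      where
      open ℕ.≤-Reasoning
      l≤k : l ≤ k
      l≤k = ℕ.≤-trans (ℕ.m≤m+n l l) 2l≤k
      half : k ≤ 2 * (k ∸ l)
      half = begin
        k                        ≡⟨ ℕ.m∸n+n≡m l≤k ⟨
        k ∸ l + l                ≤⟨ ℕ.+-monoʳ-≤ (k ∸ l) (ℕ.m+n≤o⇒m≤o∸n l 2l≤k) ⟩
        k ∸ l + (k ∸ l)          ≡⟨ cong (k ∸ l +_) (ℕ.+-identityʳ (k ∸ l)) ⟨
        2 * (k ∸ l)              ∎
      rearrange : ∀ p c → p * (2 * c) ≡ 2 * (p * c)
      rearrange = solve-∀

    -- The factor 8 is a product of three twos: at least one whole copy fits, so the whole copies
    -- make up at least half of n; only k of the 2k copies in each start a chord; and Q^l ≤ 2 D l.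
    level-lightness : ∀ {l n} → l + l ≤ k → Q ^ suc l < n → n * q ≤ 8 * ∑ n (λ x → ∑ n (levelWeight l x))
    level-lightness {l} {suc n} 2l≤k Q^<n = begin
      suc n * q                          ≤⟨ ℕ.*-monoˡ-≤ q n≤ ⟩
      8 * (B * (k * D l)) * q            ≡⟨ rearrange B k (D l) q ⟩
      8 * (B * (k * (q * D l)))          ≤⟨ ℕ.*-monoʳ-≤ 8 (level-sum l (suc n) B (s≤s (ℕ.m/n*n≤m n P))) ⟩
      8 * ∑ (suc n) (λ x → ∑ (suc n) (levelWeight l x)) ∎
      where
      open ℕ.≤-Reasoning
      P : ℕ
      P = Q ^ suc l
      instance
        P-nonZero : NonZero P
        P-nonZero = ℕ.m^n≢0 Q (suc l)
      B : ℕ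
      B = n / P
      1≤B : 1 ≤ B
      1≤B = ℕ.m≥n⇒m/n>0 (ℕ.≤-pred Q^<n)
      n≤ : suc n ≤ 8 * (B * (k * D l))
      n≤ = begin
        suc n                        ≡⟨ cong suc (ℕ.m≡m%n+[m/n]*n n P) ⟩
        suc (n % P) + B * P          ≤⟨ ℕ.+-monoˡ-≤ (B * P) (ℕ.m%n<n n P) ⟩
        P + B * P                    ≤⟨ ℕ.+-monoˡ-≤ (B * P) (ℕ.≤-trans (ℕ.≤-reflexive (sym (ℕ.*-identityˡ P))) (ℕ.*-monoˡ-≤ P 1≤B)) ⟩
        B * P + B * P                ≡⟨ rearrange₁ B k (Q ^ l) ⟩
        4 * (B * (k * Q ^ l))        ≤⟨ ℕ.*-monoʳ-≤ 4 (ℕ.*-monoʳ-≤ B (ℕ.*-monoʳ-≤ k (Q^≤2D l 2l≤k))) ⟩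
        4 * (B * (k * (2 * D l)))    ≡⟨ rearrange₂ B k (D l) ⟩
        8 * (B * (k * D l))          ∎
        where
        rearrange₁ : ∀ b k p → b * ((k + k) * p) + b * ((k + k) * p) ≡ 4 * (b * (k * p))
        rearrange₁ = solve-∀
        rearrange₂ : ∀ b k d → 4 * (b * (k * (2 * d))) ≡ 8 * (b * (k * d))
        rearrange₂ = solve-∀
      rearrange : ∀ b k d q → 8 * (b * (k * d)) * q ≡ 8 * (b * (k * (q * d)))
      rearrange = solve-∀

    chord-sum : ∀ {n} → m + m ≤ suc k → Q ^ m < n → m * (n * q) ≤ 8 * ∑ n (λ x → ∑ n (C x))
    chord-sum {n} 2m≤k+1 Q^m<n = begin
      m * (n * q)                                          ≡⟨ ∑-const m (n * q) ⟨
      ∑ m (λ _ → n * q)                                    ≤⟨ ∑-mono m (λ l l<m → level-lightness {l} (2l≤k l<m) (ℕ.≤-<-trans (ℕ.^-monoʳ-≤ Q l<m) Q^m<n)) ⟩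
      ∑ m (λ l → 8 * ∑ n (λ x → ∑ n (levelWeight l x)))    ≡⟨ ∑-* m 8 (λ l → ∑ n (λ x → ∑ n (levelWeight l x))) ⟨
      8 * ∑ m (λ l → ∑ n (λ x → ∑ n (levelWeight l x)))    ≡⟨ cong (8 *_) swapped ⟩
      8 * ∑ n (λ x → ∑ n (C x))                            ∎
      where
      open ℕ.≤-Reasoning
      2l≤k : ∀ {l} → l < m → l + l ≤ k
      2l≤k {l} l<m = ℕ.≤-pred (ℕ.≤-trans (ℕ.≤-trans (s≤s (ℕ.+-monoʳ-≤ l (ℕ.n≤1+n l))) (ℕ.+-mono-≤ l<m l<m)) 2m≤k+1)
      swapped : ∑ m (λ l → ∑ n (λ x → ∑ n (levelWeight l x))) ≡ ∑ n (λ x → ∑ n (C x))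
      swapped = trans (∑-swap m n (λ l x → ∑ n (levelWeight l x)))
                      (∑-cong n (λ x → ∑-swap m n (λ l → levelWeight l x)))

    -- By r ≤ 3k the coefficient is at most 4k², hence at most 9q² since 2k ≤ 3q. One factor q is
    -- replaced by 2m, where m is the number of levels, and each level brings the factor 8: 144 = 9
    -- · 2 · 8.
    lightness : ∀ {r n} → 2 ≤ q → q ≤ m + m → m + m ≤ suc k → r ≤ 3 * k → Q ^ m < n →
                (r * k + k * k) * n ≤ 144 * ∑ n (λ x → ∑ n (C x))
    lightness {r} {n} 2≤q q≤2m 2m≤k+1 r≤3k Q^m<n = begin
      (r * k + k * k) * n              ≤⟨ ℕ.*-monoˡ-≤ n (ℕ.+-monoˡ-≤ (k * k) (ℕ.*-monoˡ-≤ k r≤3k)) ⟩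
      (3 * k * k + k * k) * n          ≡⟨ rearrange₁ k n ⟩
      2 * k * (2 * k) * n              ≤⟨ ℕ.*-monoˡ-≤ n (ℕ.*-mono-≤ 2k≤3q 2k≤3q) ⟩
      3 * q * (3 * q) * n              ≡⟨ rearrange₂ q n ⟩
      9 * (q * (n * q))                ≤⟨ ℕ.*-monoʳ-≤ 9 (ℕ.*-monoˡ-≤ (n * q) q≤2m) ⟩
      9 * ((m + m) * (n * q))          ≡⟨ rearrange₃ m (n * q) ⟩
      18 * (m * (n * q))               ≤⟨ ℕ.*-monoʳ-≤ 18 (chord-sum 2m≤k+1 Q^m<n) ⟩
      18 * (8 * total)                 ≡⟨ ℕ.*-assoc 18 8 total ⟨
      144 * total                      ∎
      where
      open ℕ.≤-Reasoning
      total : ℕ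
      total = ∑ n (λ x → ∑ n (C x))
      2k≤3q : 2 * k ≤ 3 * q
      2k≤3q = ℕ.≤-trans (ℕ.≤-reflexive (expand q)) (ℕ.+-monoˡ-≤ (2 * q) 2≤q)
        where
        expand : ∀ q → 2 * suc q ≡ 2 + 2 * q
        expand = solve-∀
      rearrange₁ : ∀ k n → (3 * k * k + k * k) * n ≡ 2 * k * (2 * k) * n
      rearrange₁ = solve-∀
      rearrange₂ : ∀ q n → 3 * q * (3 * q) * n ≡ 9 * (q * (n * q))
      rearrange₂ = solve-∀
      rearrange₃ : ∀ m z → 9 * ((m + m) * z) ≡ 18 * (m * z)
      rearrange₃ = solve-∀

-- Lightness of both constructions and the choice between them

open Combinatorics
open import Data.Rational using (_+_; _*_; _≤_; _<_)

c₀ : ℚ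
c₀ = ℤ.+ 1 ℚ./ 144

HasLightness : ℕ → ℚ → ℚ → ℕ → Set
HasLightness r ε ρ n = Σ (WGraph n) λ G →
  (¬ HasMinor G r) ×
  IsConnected (adj G) ×
  (∀ (H : EdgeSet n) → IsSpanner (1ℚ + ε) G H →
   ∀ (T : EdgeSet n) → IsMST G T →
   c₀ * (ℕ→ℚ r * ρ + ρ * ρ) * totalWeight G T ≤ totalWeight G H)

module _ (C : ℕ → ℕ → ℕ) (chord-long : ∀ {x y} → 0 ℕ.< C x y → suc x ℕ.< y) where
  open ChordedPath C chord-long

  -- A spanner weighs at least as much as all chords and a minimum spanning tree at most n - 1.
  -- Rounding ρ = 1/ε up to K = q + 1 in the coefficient leaves an inequality between natural
  -- numbers.
  chordedPath-hasLightness :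
    ∀ {r n q ε ρ w} {E : ℕ → ℕ → Set} →
    0ℚ ≤ ρ → ρ ≤ ℕ→ℚ (suc q) → ℕ→ℚ q * ε < 1ℚ →
    (∀ {x} → E x (suc x)) → (∀ {x y} → 0 ℕ.< C x y → E x y) →
    Elimination E w → suc w ℕ.< r →
    (∀ x y → 0 ℕ.< C x y → Necessary q x y) →
    (r ℕ.* suc q ℕ.+ suc q ℕ.* suc q) ℕ.* n ℕ.≤ 144 ℕ.* ∑ n (λ x → ∑ n (C x)) →
    HasLightness r ε ρ n
  chordedPath-hasLightness {r} {n} {q} {ε} {ρ} {E = E} 0≤ρ ρ≤K qε<1 path-E chord-E elim w<r necessary light =
    graph n , elimination⇒¬HasMinor (graph n) adj⇒E elim w<r , graph-connected n , spanner-bound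
    where
    up⇒E : ∀ {x y} → 0 ℕ.< up x y → E x y
    up⇒E {x} {y} pos with up-positive {x} {y} pos
    ... | inj₁ refl = path-E
    ... | inj₂ pos′ = chord-E pos′

    adj⇒E : ∀ {u v} → adj (graph n) u v ≡ true → E (toℕ u) (toℕ v) ⊎ E (toℕ v) (toℕ u)
    adj⇒E {u} {v} e = Sum.map up⇒E up⇒E (weight-positive {toℕ u} {toℕ v} (true-<ᵇ {0} e))

    K A total : ℕ
    K = suc q
    A = r ℕ.* K ℕ.+ K ℕ.* K
    total = ∑ n (λ x → ∑ n (C x))

    coefficient : ℕ→ℚ r * ρ + ρ * ρ ≤ ℕ→ℚ A
    coefficient = ℚ.≤-trans
      (ℚ.+-mono-≤ (ℚ.*-monoˡ-≤-nonNeg (ℕ→ℚ r) {{ℚ.nonNegative (0≤ℕ→ℚ r)}} ρ≤K)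
                  (*-mono-≤-nonNeg 0≤ρ (0≤ℕ→ℚ K) ρ≤K ρ≤K))
      (ℚ.≤-reflexive (trans (cong₂ _+_ (sym (ℕ→ℚ-* r K)) (sym (ℕ→ℚ-* K K))) (sym (ℕ→ℚ-+ (r ℕ.* K) (K ℕ.* K)))))

    0≤coefficient : 0ℚ ≤ ℕ→ℚ r * ρ + ρ * ρ
    0≤coefficient = ℚ.≤-trans (ℚ.≤-reflexive (sym (trans (cong₂ _+_ (ℚ.*-zeroʳ (ℕ→ℚ r)) (ℚ.*-zeroʳ 0ℚ)) (ℚ.+-identityʳ 0ℚ))))
      (ℚ.+-mono-≤ (ℚ.*-monoˡ-≤-nonNeg (ℕ→ℚ r) {{ℚ.nonNegative (0≤ℕ→ℚ r)}} 0≤ρ)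
                  (*-mono-≤-nonNeg ℚ.≤-refl 0≤ρ 0≤ρ 0≤ρ))

    spanner-bound : ∀ H → IsSpanner (1ℚ + ε) (graph n) H → ∀ T → IsMST (graph n) T →
      c₀ * (ℕ→ℚ r * ρ + ρ * ρ) * totalWeight (graph n) T ≤ totalWeight (graph n) H
    spanner-bound H spanner T mst = begin
      c₀ * X * totalWeight (graph n) T     ≡⟨ ℚ.*-assoc c₀ X (totalWeight (graph n) T) ⟩
      c₀ * (X * totalWeight (graph n) T)   ≤⟨ ℚ.*-monoˡ-≤-nonNeg c₀ (begin
        X * totalWeight (graph n) T         ≤⟨ ℚ.*-monoˡ-≤-nonNeg X {{ℚ.nonNegative 0≤coefficient}}
                                                 (ℚ.≤-trans (MST-weight n T mst) (ℕ→ℚ-mono-≤ {n ℕ.∸ 1} {n} (ℕ.m∸n≤m n 1))) ⟩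
        X * ℕ→ℚ n                           ≤⟨ ℚ.*-monoʳ-≤-nonNeg (ℕ→ℚ n) {{ℚ.nonNegative (0≤ℕ→ℚ n)}} coefficient ⟩
        ℕ→ℚ A * ℕ→ℚ n                       ≡⟨ ℕ→ℚ-* A n ⟨
        ℕ→ℚ (A ℕ.* n)                       ≤⟨ ℕ→ℚ-mono-≤ {A ℕ.* n} {144 ℕ.* total} light ⟩
        ℕ→ℚ (144 ℕ.* total)                 ≡⟨ ℕ→ℚ-* 144 total ⟩
        ℕ→ℚ 144 * ℕ→ℚ total                 ∎) ⟩
      c₀ * (ℕ→ℚ 144 * ℕ→ℚ total)           ≡⟨ ℚ.*-assoc c₀ (ℕ→ℚ 144) (ℕ→ℚ total) ⟨
      -- The product of `c₀` and `ℕ→ℚ 144` evaluates to `1ℚ`.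
      1ℚ * ℕ→ℚ total                      ≡⟨ ℚ.*-identityˡ (ℕ→ℚ total) ⟩
      ℕ→ℚ total                           ≤⟨ spanner-weight {q} {ε} qε<1 necessary spanner ⟩
      totalWeight (graph n) H             ∎
      where
      open ℚ.≤-Reasoning
      X : ℚ
      X = ℕ→ℚ r * ρ + ρ * ρ

bandwidth-hasLightness : ∀ {r n q ε ρ} → 0ℚ ≤ ρ → ρ ≤ ℕ→ℚ (suc q) → ℕ→ℚ q * ε < 1ℚ →
               0 ℕ.< q → suc q ℕ.* 3 ℕ.≤ r → r ℕ.≤ n → HasLightness r ε ρ n
bandwidth-hasLightness {r} {n} {q} {ε} {ρ} 0≤ρ ρ≤K qε<1 0<q 3K≤r r≤n =
  chordedPath-hasLightness B.C B.chord-long {E = λ x y → x ℕ.≤ y × y ℕ.≤ x ℕ.+ (h ℕ.+ h ℕ.∸ 1)}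
    0≤ρ ρ≤K qε<1
    (λ {x} → ℕ.n≤1+n x , ℕ.≤-trans (ℕ.≤-reflexive (ℕ.+-comm 1 x)) (ℕ.+-monoʳ-≤ x 1≤2h-1))
    (λ {x} {y} pos → ℕ.<⇒≤ (ℕ.<-trans (ℕ.n<1+n x) (B.chord-long pos)) , span pos)
    (bandwidth-elimination (h ℕ.+ h ℕ.∸ 1)) narrow B.necessary (B.lightness 3h≤r r≤4h r≤n)
  where
  -- The width of the elimination is 2h - 1, and 2h < 3h ≤ r excludes the minor; 3K ≤ r gives q < h.
  h : ℕ
  h = r ℕ./ 3
  q<h : q ℕ.< h
  q<h = subst (ℕ._≤ h) (ℕ.m*n/n≡m (suc q) 3) (ℕ./-monoˡ-≤ 3 3K≤r)
  module B = Bandwidth q h 0<q q<h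
  2≤h : 2 ℕ.≤ h
  2≤h = ℕ.≤-trans (s≤s 0<q) q<h
  3h≤r : h ℕ.* 3 ℕ.≤ r
  3h≤r = ℕ.m/n*n≤m r 3
  2h : suc (h ℕ.+ h ℕ.∸ 1) ≡ h ℕ.+ h
  2h = ℕ.m+[n∸m]≡n {1} (ℕ.≤-trans (ℕ.<⇒≤ 2≤h) (ℕ.m≤m+n h h))
  1≤2h-1 : 1 ℕ.≤ h ℕ.+ h ℕ.∸ 1
  1≤2h-1 = ℕ.≤-pred (ℕ.≤-trans (ℕ.≤-trans 2≤h (ℕ.m≤m+n h h)) (ℕ.≤-reflexive (sym 2h)))
  narrow : suc (h ℕ.+ h ℕ.∸ 1) ℕ.< r
  narrow = ℕ.<-≤-trans (ℕ.≤-<-trans (ℕ.≤-reflexive 2h) (ℕ.m<n+m (h ℕ.+ h) (ℕ.<⇒≤ 2≤h)))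
    (ℕ.≤-trans (ℕ.≤-reflexive (thrice h)) 3h≤r)
    where
    thrice : ∀ h → h ℕ.+ (h ℕ.+ h) ≡ h ℕ.* 3
    thrice = solve-∀
  span : ∀ {x y} → 0 ℕ.< B.C x y → y ℕ.≤ x ℕ.+ (h ℕ.+ h ℕ.∸ 1)
  span {x} {y} pos = ℕ.≤-pred (ℕ.≤-trans (proj₂ (B.chord-range {x} {y} pos))
    (ℕ.≤-reflexive (trans (cong (x ℕ.+_) (sym 2h)) (ℕ.+-suc x (h ℕ.+ h ℕ.∸ 1)))))
  r≤4h : r ℕ.≤ h ℕ.* 4
  r≤4h = ℕ.≤-trans (ℕ.≤-reflexive (ℕ.m≡m%n+[m/n]*n r 3))
    (ℕ.≤-trans (ℕ.+-monoˡ-≤ (h ℕ.* 3) (ℕ.≤-trans (ℕ.≤-pred (ℕ.m%n<n r 3)) 2≤h)) (ℕ.≤-reflexive (sym (ℕ.*-suc h 3))))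

ladder-hasLightness : ∀ {r n q ε ρ} → 0ℚ ≤ ρ → ρ ≤ ℕ→ℚ (suc q) → ℕ→ℚ q * ε < 1ℚ →
               6 ℕ.≤ r → r ℕ.≤ 3 ℕ.* suc q → 2 ℕ.≤ q → q ℕ.^ (3 ℕ.* suc q) ℕ.< n → HasLightness r ε ρ n
ladder-hasLightness {r} {n} {q@(suc q-1)} {ε} {ρ} 0≤ρ ρ≤K qε<1 6≤r r≤3K 2≤q q^3K<n =
  chordedPath-hasLightness R.C R.chord-long {E = Ladder.Edge q m}
    0≤ρ ρ≤K qε<1 Ladder.path R.chord-edge
    -- For width 4 the required `suc 4 < r` unfolds to 6 ≤ r.
    (Ladder.ladder-elimination q m) 6≤r R.necessary (R.lightness 2≤q q≤2m 2m≤q+2 r≤3K Q^m<n)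
  where
  -- About q/2 levels: few enough that Bernoulli's inequality loses only a factor of two, and enough
  -- to gain a factor of order q.
  m : ℕ
  m = ⌈ q /2⌉
  module R = Recursive q-1 m
  q≤2m : q ℕ.≤ m ℕ.+ m
  q≤2m = ℕ.≤-trans (ℕ.≤-reflexive (sym (ℕ.⌊n/2⌋+⌈n/2⌉≡n q))) (ℕ.+-monoˡ-≤ m (ℕ.⌊n/2⌋≤⌈n/2⌉ q))
  2m≤q+2 : m ℕ.+ m ℕ.≤ suc (suc q)
  2m≤q+2 = ℕ.≤-trans (ℕ.+-monoʳ-≤ m (ℕ.⌊n/2⌋≤⌈n/2⌉ (suc q)))
    (ℕ.≤-trans (ℕ.≤-reflexive (ℕ.⌊n/2⌋+⌈n/2⌉≡n (suc q))) (ℕ.n≤1+n (suc q)))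
  -- This is the source of the exponent 3 in the theorem: for q ≥ 2 it gives Q^m ≤ q^(3m) ≤ q^(3K),
  -- so a copy of depth m fits.
  Q≤q³ : suc q ℕ.+ suc q ℕ.≤ q ℕ.^ 3
  Q≤q³ = begin
    suc q ℕ.+ suc q                 ≡⟨ expand q ⟩
    2 ℕ.+ 2 ℕ.* q                   ≤⟨ ℕ.+-monoˡ-≤ (2 ℕ.* q) (ℕ.≤-trans 2≤q (ℕ.m≤m+n q (q ℕ.+ 0))) ⟩
    2 ℕ.* q ℕ.+ 2 ℕ.* q             ≡⟨ collect q ⟩
    2 ℕ.* (2 ℕ.* (q ℕ.* 1))         ≤⟨ ℕ.*-mono-≤ 2≤q (ℕ.*-monoˡ-≤ (q ℕ.* 1) 2≤q) ⟩
    q ℕ.^ 3                         ∎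
    where
    open ℕ.≤-Reasoning
    expand : ∀ q → suc q ℕ.+ suc q ≡ 2 ℕ.+ 2 ℕ.* q
    expand = solve-∀
    collect : ∀ q → 2 ℕ.* q ℕ.+ 2 ℕ.* q ≡ 2 ℕ.* (2 ℕ.* (q ℕ.* 1))
    collect = solve-∀
  Q^m<n : (suc q ℕ.+ suc q) ℕ.^ m ℕ.< n
  Q^m<n = begin-strict
    (suc q ℕ.+ suc q) ℕ.^ m   ≤⟨ ℕ.^-monoˡ-≤ m Q≤q³ ⟩
    (q ℕ.^ 3) ℕ.^ m           ≡⟨ ℕ.^-*-assoc q 3 m ⟩
    q ℕ.^ (3 ℕ.* m)           ≤⟨ ℕ.^-monoʳ-≤ q (ℕ.*-monoʳ-≤ 3 (ℕ.≤-trans (ℕ.⌈n/2⌉≤n q) (ℕ.n≤1+n q))) ⟩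
    q ℕ.^ (3 ℕ.* suc q)       <⟨ q^3K<n ⟩
    n                         ∎
    where open ℕ.≤-Reasoning

theorem1p2 : Σ ℕ λ a → Σ ℚ λ c →
    (1 Data.Nat.≤ a) × (0ℚ < c) ×
    (∀ (r : ℕ) → 6 Data.Nat.≤ r →
    ∀ (ε : ℚ) (ε>0 : 0ℚ < ε) → ε < 1ℚ →
    ∀ (n : ℕ) → ℕ→ℚ r + (inv ε ε>0 ^ℚ (a Data.Nat.* ceilℕ (inv ε ε>0))) ≤ ℕ→ℚ n →
    Σ (WGraph n) λ G →
    (¬ HasMinor G r) ×
    IsConnected (adj G) ×
    (∀ (H : EdgeSet n) → IsSpanner (1ℚ + ε) G H →
    ∀ (T : EdgeSet n) → IsMST G T →
    c * (ℕ→ℚ r * inv ε ε>0 + inv ε ε>0 * inv ε ε>0) * totalWeight G T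
    ≤ totalWeight G H))
theorem1p2 = 3 , c₀ , s≤s z≤n , *<* (ℤ.+<+ (s≤s z≤n)) , light
  where
  light : ∀ r → 6 ℕ.≤ r → ∀ ε (ε>0 : 0ℚ < ε) → ε < 1ℚ → ∀ n →
          ℕ→ℚ r + (inv ε ε>0 ^ℚ (3 ℕ.* ceilℕ (inv ε ε>0))) ≤ ℕ→ℚ n → HasLightness r ε (inv ε ε>0) n
  light r 6≤r ε ε>0 ε<1 n size = cases (ceilℕ-bounds ρ ρ>0)
    where
    instance
      ε-positive : ℚ.Positive ε
      ε-positive = ℚ.positive ε>0
    ρ : ℚ
    ρ = inv ε ε>0
    ρ>0 : 0ℚ < ρ
    ρ>0 = ℚ.positive⁻¹ ρ {{ℚ.1/pos⇒pos ε}}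
    ρε≡1 : ρ * ε ≡ 1ℚ
    ρε≡1 = ℚ.*-inverseˡ ε {{ℚ.pos⇒nonZero ε}}

    cases : (∃ λ q → ceilℕ ρ ≡ suc q × ℕ→ℚ q < ρ × ρ ≤ ℕ→ℚ (suc q)) → HasLightness r ε ρ n
    -- A ceiling of 1 would mean 1/ε ≤ 1, against ε < 1.
    cases (zero , _ , _ , ρ≤1) = ⊥-elim (ℚ.<-irrefl refl (ℚ.≤-<-trans
      (ℚ.≤-trans (ℚ.≤-reflexive (sym ρε≡1)) (ℚ.≤-trans (ℚ.*-monoʳ-≤-nonNeg ε {{ℚ.pos⇒nonNeg ε}} ρ≤1) (ℚ.≤-reflexive (ℚ.*-identityˡ ε)))) ε<1))
    cases (q@(suc _) , K≡ , q<ρ , ρ≤K) = split (suc q ℕ.* 3 ℕ.≤? r)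
      where
      qε<1 : ℕ→ℚ q * ε < 1ℚ
      qε<1 = ℚ.<-≤-trans (ℚ.*-monoˡ-<-pos ε q<ρ) (ℚ.≤-reflexive ρε≡1)
      power : ℕ
      power = q ℕ.^ (3 ℕ.* suc q)
      -- Since q < 1/ε, replacing the rational power by one of q turns the size hypothesis into an
      -- inequality of natural numbers.
      size′ : r ℕ.+ power ℕ.≤ n
      size′ = ℕ→ℚ-cancel-≤ {r ℕ.+ power} {n} (ℚ.≤-trans
        (ℚ.≤-trans (ℚ.≤-reflexive (ℕ→ℚ-+ r power)) (ℚ.+-monoʳ-≤ (ℕ→ℚ r) (^ℚ-lower q (3 ℕ.* suc q) (ℚ.<⇒≤ q<ρ))))
        (subst (λ K → ℕ→ℚ r + ρ ^ℚ (3 ℕ.* K) ≤ ℕ→ℚ n) K≡ size))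
      split : Dec (suc q ℕ.* 3 ℕ.≤ r) → HasLightness r ε ρ n
      split (yes 3K≤r) = bandwidth-hasLightness {q = q} {ε} (ℚ.<⇒≤ ρ>0) ρ≤K qε<1 (s≤s z≤n) 3K≤r (ℕ.≤-trans (ℕ.m≤m+n r power) size′)
      split (no 3K≰r) = ladder-hasLightness {q = q} {ε} (ℚ.<⇒≤ ρ>0) ρ≤K qε<1 6≤r
        (ℕ.≤-trans (ℕ.<⇒≤ r<3K) (ℕ.≤-reflexive (ℕ.*-comm (suc q) 3)))
        -- From 6 ≤ r < 3 (q + 1) it follows that q ≥ 2.
        (ℕ.≤-pred (ℕ.*-cancelʳ-< 3 2 (suc q) (ℕ.≤-<-trans 6≤r r<3K)))
        (ℕ.<-≤-trans (ℕ.m<n+m power (ℕ.≤-trans (s≤s z≤n) 6≤r)) size′)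
        where
        r<3K : r ℕ.< suc q ℕ.* 3
        r<3K = ℕ.≰⇒> 3K≰r
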